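{- Let $m$ be a complex number, $x$ an indeterminate, and let $\mathcal{A}_m(n,x)=\sum_{k=0}^n k!\,W_m(n,k)(x-1)^{n-k}$ be the Eulerian-Dowling polynomials. Then, as formal power series in $z$, $$\sum_{n=0}^{\infty}\mathcal{A}_m(n,x)z^n=\cfrac{1}{1-b_0z-\cfrac{\lambda_1z^2}{1-b_1z-\cfrac{\lambda_2z^2}{1-b_2z-\cfrac{\lambda_3z^2}{1-b_3z-\cdots}}}},$$ where $b_n=x(nm+1)-n(m-2)$ for $n\ge 0$ and $\lambda_n=n^2(m(x-1)+1)$ for $n\ge 1$. In particular, the Hankel transform $h_n=\det\big(\mathcal{A}_m(i+j,x)\big)_{0\le i,j\le n}$ of the sequence $(\mathcal{A}_m(n,x))_{n\ge 0}$ is, for all $n\ge 0$, $$h_n=(m(x-1)+1)^{\binom{n+1}{2}}\prod_{k=0}^n k!^2.$$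
   Context: The Whitney numbers of the second kind of Dowling lattices are $W_m(n,k)=\sum_{i=k}^n\binom{n}{i}m^{i-k}S(i,k)$ (with $0^0=1$), where $S(i,k)$ are the Stirling numbers of the second kind; for $m\ne 0$ this is equivalent to $\sum_{n\ge 0} W_m(n,k)\frac{z^n}{n!}=\frac{e^z}{m^k k!}(e^{mz}-1)^k$, and $W_0(n,k)=\binom{n}{k}$. The infinite continued fraction denotes the limit, in the $z$-adic topology on $\mathbb{C}[x][[z]]$, of its finite truncations. The Hankel transform of a sequence $(a_n)_{n\ge 0}$ is the sequence of determinants $h_n=\det(a_{i+j})_{0\le i,j\le n}$. -}

module Defs where

open import Algebra.Bundles using (CommutativeRing; CommutativeMonoid)
open import Data.Fin.Base using (Fin; zero; suc; toℕ; punchIn)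
open import Data.List.Base using (List; []; _∷_; map)
open import Data.Nat.Base as ℕ using (ℕ; zero; suc; _∸_; _≤_; _<_; _!)
open import Data.Nat.Combinatorics using (_C_)
open import Data.Product.Base using (_,_; ∃-syntax)
open import Data.Vec.Functional as Vector using (Vector)
open import Function.Base using (_∘_)
open import Level using (Level)
open import Relation.Binary.PropositionalEquality.Core as ≡ using (_≡_)

import Algebra.Properties.CommutativeSemigroup as CommutativeSemigroupProperties
import Algebra.Properties.Ring as RingProperties
import Algebra.Properties.Semiring.Exp as Exp
import Algebra.Properties.Semiring.Mult as Mult
import Algebra.Properties.Semiring.Sum as Sum
import Relation.Binary.Reasoning.Setoid as SetoidReasoning

private
  variable
    c ℓ : Level

-- Coefficient lists, constant term first.  Trailing zeros are allowed:
-- two lists are equal when all their coefficients agree.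

module Polynomial (R : CommutativeRing c ℓ) where

  private
    module R = CommutativeRing R
    module S = SetoidReasoning R.setoid
  open R using (_≈_; 0#; 1#) renaming (Carrier to K)

  Poly : Set c
  Poly = List K

  coeff : Poly → ℕ → K
  coeff []      _       = 0#
  coeff (a ∷ _) zero    = a
  coeff (_ ∷ p) (suc n) = coeff p n

  infix  4 _≋_
  infixl 6 _+_
  infixl 7 _*_ _·_
  infix  8 -_

  record _≋_ (p q : Poly) : Set ℓ where
    constructor mk≋
    field coeff-≈ : ∀ n → coeff p n ≈ coeff q n
  open _≋_ public

  _+_ : Poly → Poly → Poly
  []      + q       = q
  (a ∷ p) + []      = a ∷ p
  (a ∷ p) + (b ∷ q) = (a R.+ b) ∷ (p + q)

  _·_ : K → Poly → Poly
  a · p = map (a R.*_) p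

  -_ : Poly → Poly
  -_ = map (R.-_)

  _*_ : Poly → Poly → Poly
  []      * q = []
  (a ∷ p) * q = a · q + (0# ∷ p * q)

  const : K → Poly
  const a = a ∷ []

  X : Poly
  X = 0# ∷ 1# ∷ []

  private
    coeff-+ : ∀ p q n → coeff (p + q) n ≈ coeff p n R.+ coeff q n
    coeff-+ []      q       n       = R.sym (R.+-identityˡ _)
    coeff-+ (a ∷ p) []      n       = R.sym (R.+-identityʳ _)
    coeff-+ (a ∷ p) (b ∷ q) zero    = R.refl
    coeff-+ (a ∷ p) (b ∷ q) (suc n) = coeff-+ p q n

    coeff-· : ∀ a p n → coeff (a · p) n ≈ a R.* coeff p n
    coeff-· a []      n       = R.sym (R.zeroʳ a)
    coeff-· a (b ∷ p) zero    = R.refl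
    coeff-· a (b ∷ p) (suc n) = coeff-· a p n

    coeff-neg : ∀ p n → coeff (- p) n ≈ R.- coeff p n
    coeff-neg []      n       = R.sym (RingProperties.-0#≈0# R.ring)
    coeff-neg (a ∷ p) zero    = R.refl
    coeff-neg (a ∷ p) (suc n) = coeff-neg p n

    ≋-refl : ∀ {p} → p ≋ p
    ≋-refl = mk≋ λ _ → R.refl

    ≋-sym : ∀ {p q} → p ≋ q → q ≋ p
    ≋-sym e = mk≋ λ n → R.sym (coeff-≈ e n)

    ≋-trans : ∀ {p q r} → p ≋ q → q ≋ r → p ≋ r
    ≋-trans e f = mk≋ λ n → R.trans (coeff-≈ e n) (coeff-≈ f n)

    ∷-cong : ∀ {a b p q} → a ≈ b → p ≋ q → a ∷ p ≋ b ∷ q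
    ∷-cong a≈b e = mk≋ λ { zero → a≈b ; (suc n) → coeff-≈ e n }

    0∷[]≋[] : 0# ∷ [] ≋ []
    0∷[]≋[] = mk≋ λ { zero → R.refl ; (suc n) → R.refl }

    +-cong : ∀ {p q r s} → p ≋ q → r ≋ s → p + r ≋ q + s
    +-cong {p} {q} {r} {s} e f = mk≋ λ n → S.begin
      coeff (p + r) n           S.≈⟨ coeff-+ p r n ⟩
      coeff p n R.+ coeff r n   S.≈⟨ R.+-cong (coeff-≈ e n) (coeff-≈ f n) ⟩
      coeff q n R.+ coeff s n   S.≈⟨ coeff-+ q s n ⟨
      coeff (q + s) n           S.∎

    +-assoc : ∀ p q r → (p + q) + r ≋ p + (q + r)
    +-assoc p q r = mk≋ λ n → S.begin
      coeff ((p + q) + r) n                     S.≈⟨ coeff-+ (p + q) r n ⟩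
      coeff (p + q) n R.+ coeff r n             S.≈⟨ R.+-congʳ (coeff-+ p q n) ⟩
      coeff p n R.+ coeff q n R.+ coeff r n     S.≈⟨ R.+-assoc _ _ _ ⟩
      coeff p n R.+ (coeff q n R.+ coeff r n)   S.≈⟨ R.+-congˡ (coeff-+ q r n) ⟨
      coeff p n R.+ coeff (q + r) n             S.≈⟨ coeff-+ p (q + r) n ⟨
      coeff (p + (q + r)) n                     S.∎

    +-comm : ∀ p q → p + q ≋ q + p
    +-comm p q = mk≋ λ n → S.begin
      coeff (p + q) n           S.≈⟨ coeff-+ p q n ⟩
      coeff p n R.+ coeff q n   S.≈⟨ R.+-comm _ _ ⟩
      coeff q n R.+ coeff p n   S.≈⟨ coeff-+ q p n ⟨
      coeff (q + p) n           S.∎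

    +-identityʳ : ∀ p → p + [] ≋ p
    +-identityʳ []      = ≋-refl
    +-identityʳ (a ∷ p) = ≋-refl

    neg-cong : ∀ {p q} → p ≋ q → - p ≋ - q
    neg-cong {p} {q} e = mk≋ λ n → S.begin
      coeff (- p) n   S.≈⟨ coeff-neg p n ⟩
      R.- coeff p n   S.≈⟨ R.-‿cong (coeff-≈ e n) ⟩
      R.- coeff q n   S.≈⟨ coeff-neg q n ⟨
      coeff (- q) n   S.∎

    neg-inverseʳ : ∀ p → p + - p ≋ []
    neg-inverseʳ p = mk≋ λ n → S.begin
      coeff (p + - p) n             S.≈⟨ coeff-+ p (- p) n ⟩
      coeff p n R.+ coeff (- p) n   S.≈⟨ R.+-congˡ (coeff-neg p n) ⟩
      coeff p n R.+ R.- coeff p n   S.≈⟨ R.-‿inverseʳ _ ⟩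
      0#                            S.∎

    neg-inverseˡ : ∀ p → - p + p ≋ []
    neg-inverseˡ p = ≋-trans (+-comm (- p) p) (neg-inverseʳ p)

    +-commutativeMonoid : CommutativeMonoid c ℓ
    +-commutativeMonoid = record
      { Carrier             = Poly
      ; _≈_                 = _≋_
      ; _∙_                 = _+_
      ; ε                   = []
      ; isCommutativeMonoid = record
        { isMonoid = record
          { isSemigroup = record
            { isMagma = record
              { isEquivalence = record
                { refl = ≋-refl ; sym = ≋-sym ; trans = ≋-trans }
              ; ∙-cong        = +-cong
              }
            ; assoc   = +-assoc
            }
          ; identity    = (λ _ → ≋-refl) , +-identityʳ
          }
        ; comm     = +-comm
        }
      }

    module P = SetoidReasoning (CommutativeMonoid.setoid +-commutativeMonoid)
    open CommutativeSemigroupProperties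
      (CommutativeMonoid.commutativeSemigroup +-commutativeMonoid)
      using (interchange; x∙yz≈y∙xz)

    ·-cong : ∀ {a b p q} → a ≈ b → p ≋ q → a · p ≋ b · q
    ·-cong {a} {b} {p} {q} a≈b e = mk≋ λ n → S.begin
      coeff (a · p) n   S.≈⟨ coeff-· a p n ⟩
      a R.* coeff p n   S.≈⟨ R.*-cong a≈b (coeff-≈ e n) ⟩
      b R.* coeff q n   S.≈⟨ coeff-· b q n ⟨
      coeff (b · q) n   S.∎

    ·-distribˡ-+ : ∀ a p q → a · (p + q) ≋ a · p + a · q
    ·-distribˡ-+ a p q = mk≋ λ n → S.begin
      coeff (a · (p + q)) n                   S.≈⟨ coeff-· a (p + q) n ⟩
      a R.* coeff (p + q) n                   S.≈⟨ R.*-congˡ (coeff-+ p q n) ⟩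
      a R.* (coeff p n R.+ coeff q n)         S.≈⟨ R.distribˡ a _ _ ⟩
      a R.* coeff p n R.+ a R.* coeff q n     S.≈⟨ R.+-cong (coeff-· a p n) (coeff-· a q n) ⟨
      coeff (a · p) n R.+ coeff (a · q) n     S.≈⟨ coeff-+ (a · p) (a · q) n ⟨
      coeff (a · p + a · q) n                 S.∎

    ·-assoc : ∀ a b p → (a R.* b) · p ≋ a · (b · p)
    ·-assoc a b p = mk≋ λ n → S.begin
      coeff ((a R.* b) · p) n     S.≈⟨ coeff-· (a R.* b) p n ⟩
      a R.* b R.* coeff p n       S.≈⟨ R.*-assoc a b _ ⟩
      a R.* (b R.* coeff p n)     S.≈⟨ R.*-congˡ (coeff-· b p n) ⟨
      a R.* coeff (b · p) n       S.≈⟨ coeff-· a (b · p) n ⟨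
      coeff (a · (b · p)) n       S.∎

    ·-identityˡ : ∀ p → 1# · p ≋ p
    ·-identityˡ p = mk≋ λ n → R.trans (coeff-· 1# p n) (R.*-identityˡ _)

    ·-zeroˡ : ∀ p → 0# · p ≋ []
    ·-zeroˡ p = mk≋ λ n → R.trans (coeff-· 0# p n) (R.zeroˡ _)

    *-congˡ : ∀ p {q r} → q ≋ r → p * q ≋ p * r
    *-congˡ []      e = ≋-refl
    *-congˡ (a ∷ p) e = +-cong (·-cong R.refl e) (∷-cong R.refl (*-congˡ p e))

    *-zeroʳ : ∀ p → p * [] ≋ []
    *-zeroʳ []      = ≋-refl
    *-zeroʳ (a ∷ p) = ≋-trans (∷-cong R.refl (*-zeroʳ p)) 0∷[]≋[]

    *-∷ʳ : ∀ p b q → p * (b ∷ q) ≋ b · p + (0# ∷ p * q)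
    *-∷ʳ []      b q = ≋-sym 0∷[]≋[]
    *-∷ʳ (a ∷ p) b q = ∷-cong (R.+-congʳ (R.*-comm a b)) (P.begin
      a · q + p * (b ∷ q)              P.≈⟨ +-cong ≋-refl (*-∷ʳ p b q) ⟩
      a · q + (b · p + (0# ∷ p * q))   P.≈⟨ x∙yz≈y∙xz (a · q) (b · p) _ ⟩
      b · p + (a · q + (0# ∷ p * q))   P.∎)

    *-comm : ∀ p q → p * q ≋ q * p
    *-comm []      q = ≋-sym (*-zeroʳ q)
    *-comm (a ∷ p) q = P.begin
      a · q + (0# ∷ p * q)   P.≈⟨ +-cong ≋-refl (∷-cong R.refl (*-comm p q)) ⟩
      a · q + (0# ∷ q * p)   P.≈⟨ *-∷ʳ q a p ⟨
      q * (a ∷ p)            P.∎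

    *-cong : ∀ {p q r s} → p ≋ q → r ≋ s → p * r ≋ q * s
    *-cong {p} {q} {r} {s} e f = P.begin
      p * r   P.≈⟨ *-congˡ p f ⟩
      p * s   P.≈⟨ *-comm p s ⟩
      s * p   P.≈⟨ *-congˡ s e ⟩
      s * q   P.≈⟨ *-comm s q ⟩
      q * s   P.∎

    *-distribˡ-+ : ∀ p q r → p * (q + r) ≋ p * q + p * r
    *-distribˡ-+ []      q r = ≋-refl
    *-distribˡ-+ (a ∷ p) q r = P.begin
      a · (q + r) + (0# ∷ p * (q + r))
        P.≈⟨ +-cong (·-distribˡ-+ a q r)
                    (∷-cong (R.sym (R.+-identityˡ 0#)) (*-distribˡ-+ p q r)) ⟩
      (a · q + a · r) + ((0# ∷ p * q) + (0# ∷ p * r))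
        P.≈⟨ interchange (a · q) (a · r) (0# ∷ p * q) (0# ∷ p * r) ⟩
      (a · q + (0# ∷ p * q)) + (a · r + (0# ∷ p * r)) P.∎

    *-distribʳ-+ : ∀ p q r → (q + r) * p ≋ q * p + r * p
    *-distribʳ-+ p q r = P.begin
      (q + r) * p     P.≈⟨ *-comm (q + r) p ⟩
      p * (q + r)     P.≈⟨ *-distribˡ-+ p q r ⟩
      p * q + p * r   P.≈⟨ +-cong (*-comm p q) (*-comm p r) ⟩
      q * p + r * p   P.∎

    ·-*-assoc : ∀ a p q → (a · p) * q ≋ a · (p * q)
    ·-*-assoc a []      q = ≋-refl
    ·-*-assoc a (b ∷ p) q = P.begin
      (a R.* b) · q + (0# ∷ (a · p) * q)
        P.≈⟨ +-cong (·-assoc a b q)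
                    (∷-cong (R.sym (R.zeroʳ a)) (·-*-assoc a p q)) ⟩
      a · (b · q) + a · (0# ∷ p * q)
        P.≈⟨ ·-distribˡ-+ a (b · q) (0# ∷ p * q) ⟨
      a · (b · q + (0# ∷ p * q)) P.∎

    *-assoc : ∀ p q r → (p * q) * r ≋ p * (q * r)
    *-assoc []      q r = ≋-refl
    *-assoc (a ∷ p) q r = P.begin
      (a · q + (0# ∷ p * q)) * r
        P.≈⟨ *-distribʳ-+ r (a · q) (0# ∷ p * q) ⟩
      (a · q) * r + (0# · r + (0# ∷ (p * q) * r))
        P.≈⟨ +-cong (·-*-assoc a q r)
                    (+-cong (·-zeroˡ r) (∷-cong R.refl (*-assoc p q r))) ⟩
      a · (q * r) + (0# ∷ p * (q * r)) P.∎

    *-identityˡ : ∀ p → const 1# * p ≋ p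
    *-identityˡ p = P.begin
      1# · p + (0# ∷ [])   P.≈⟨ +-cong (·-identityˡ p) 0∷[]≋[] ⟩
      p + []               P.≈⟨ +-identityʳ p ⟩
      p                    P.∎

    *-identityʳ : ∀ p → p * const 1# ≋ p
    *-identityʳ p = ≋-trans (*-comm p (const 1#)) (*-identityˡ p)

  commutativeRing : CommutativeRing c ℓ
  commutativeRing = record
    { Carrier           = Poly
    ; _≈_               = _≋_
    ; _+_               = _+_
    ; _*_               = _*_
    ; -_                = -_
    ; 0#                = []
    ; 1#                = const 1#
    ; isCommutativeRing = record
      { isRing = record
        { +-isAbelianGroup = record
          { isGroup = record
            { isMonoid = CommutativeMonoid.isMonoid +-commutativeMonoid
            ; inverse  = neg-inverseˡ , neg-inverseʳ
            ; ⁻¹-cong  = neg-cong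
            }
          ; comm    = +-comm
          }
        ; *-cong           = *-cong
        ; *-assoc          = *-assoc
        ; *-identity       = *-identityˡ , *-identityʳ
        ; distrib          = *-distribˡ-+ , *-distribʳ-+
        }
      ; *-comm = *-comm
      }
    }

module PowerSeries (A : CommutativeRing c ℓ) where

  private module A = CommutativeRing A
  open A using (_≈_; 0#; 1#) renaming (Carrier to K)
  open Sum A.semiring using (sum-syntax; sum-cong-≗)

  Series : Set c
  Series = ℕ → K

  infixl 6 _-_
  infixl 7 _*_ _·_
  infix  8 1/_

  𝟙 : Series
  𝟙 zero    = 1#
  𝟙 (suc _) = 0#

  z : Series
  z 1 = 1#
  z _ = 0#

  _-_ : Series → Series → Series
  (f - g) n = f n A.- g n

  _·_ : K → Series → Series
  (a · f) n = a A.* f n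

  _*_ : Series → Series → Series
  (f * g) n = ∑[ i < suc n ] (f (toℕ i) A.* g (n ∸ toℕ i))

  -- The multiplicative inverse g of a series f with constant term 1:
  -- g₀ = 1 and gₙ₊₁ = - ∑_{i ≤ n} fᵢ₊₁ gₙ₋ᵢ.  (It is meaningless when
  -- the constant term of f is not 1.)  The vector recipCoeffs f n is
  -- (gₙ , … , g₁ , g₀).
  recipCoeffs : Series → (n : ℕ) → Vector K (suc n)
  recipCoeffs f zero    = λ _ → 1#
  recipCoeffs f (suc n) =
    (A.- (∑[ i < suc n ] (f (suc (toℕ i)) A.* recipCoeffs f n i)))
    Vector.∷ recipCoeffs f n

  1/_ : Series → Series
  (1/ f) n = Vector.head (recipCoeffs f n)

  private
    recipCoeffs-lookup : ∀ f n i → recipCoeffs f n i ≡ (1/ f) (n ∸ toℕ i)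
    recipCoeffs-lookup f n       zero    = ≡.refl
    recipCoeffs-lookup f (suc n) (suc i) = recipCoeffs-lookup f n i

  1/-inverseʳ : ∀ f → f 0 ≈ 1# → ∀ n → (f * 1/ f) n ≈ 𝟙 n
  1/-inverseʳ f f₀≈1 zero = begin
    f 0 A.* 1# A.+ 0#   ≈⟨ A.+-identityʳ _ ⟩
    f 0 A.* 1#          ≈⟨ A.*-identityʳ _ ⟩
    f 0                 ≈⟨ f₀≈1 ⟩
    1#                  ∎
    where open SetoidReasoning A.setoid
  1/-inverseʳ f f₀≈1 (suc n) = begin
    f 0 A.* (A.- s) A.+ t   ≈⟨ A.+-congʳ (A.*-congʳ f₀≈1) ⟩
    1# A.* (A.- s) A.+ t    ≈⟨ A.+-congʳ (A.*-identityˡ _) ⟩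
    A.- s A.+ t             ≡⟨ ≡.cong (A.- s A.+_) t≡s ⟩
    A.- s A.+ s             ≈⟨ A.-‿inverseˡ s ⟩
    0#                      ∎
    where
    open SetoidReasoning A.setoid
    s = ∑[ i < suc n ] (f (suc (toℕ i)) A.* recipCoeffs f n i)
    t = ∑[ i < suc n ] (f (suc (toℕ i)) A.* (1/ f) (n ∸ toℕ i))
    t≡s : t ≡ s
    t≡s = sum-cong-≗ λ i →
      ≡.cong (f (suc (toℕ i)) A.*_) (≡.sym (recipCoeffs-lookup f n i))

  infix 4 _⟶_

  -- Convergence in the z-adic topology: for every d, eventually F N and f
  -- agree modulo z^d.
  _⟶_ : (ℕ → Series) → Series → Set ℓ
  F ⟶ f = ∀ d → ∃[ N₀ ] (∀ N → N₀ ≤ N → ∀ i → i < d → F N i ≈ f i)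

  -- convergent b lam N is the truncation
  --   1/(1 - b₀z - lam₁z²/(1 - b₁z - ⋯ - lam_N z²/(1 - b_N z)))
  -- of the infinite continued fraction; lam 0 is never used.
  convergent : (b lam : ℕ → K) → ℕ → Series
  convergent b lam zero    = 1/ (𝟙 - b 0 · z)
  convergent b lam (suc N) =
    1/ (𝟙 - b 0 · z - lam 1 · (z * z * convergent (b ∘ suc) (lam ∘ suc) N))

module Determinant (A : CommutativeRing c ℓ) where

  open CommutativeRing A hiding (zero)
  open Exp semiring using (_^_)
  open Sum semiring using (sum-syntax)

  det : ∀ {n} → (Fin n → Fin n → Carrier) → Carrier
  det {zero}  M = 1#
  det {suc n} M =
    ∑[ j < suc n ] ((- 1#) ^ toℕ j * (M zero j * det (λ i k → M (suc i) (punchIn j k))))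

  hankelTransform : (ℕ → Carrier) → ℕ → Carrier
  hankelTransform a n = det {suc n} (λ i j → a (toℕ i ℕ.+ toℕ j))

stirling₂ : ℕ → ℕ → ℕ
stirling₂ zero    zero    = 1
stirling₂ zero    (suc k) = 0
stirling₂ (suc n) zero    = 0
stirling₂ (suc n) (suc k) = suc k ℕ.* stirling₂ n (suc k) ℕ.+ stirling₂ n k

-- The standard library has no complex numbers, so the coefficients are taken
-- in an arbitrary commutative ring R; the classical setting is R = ℂ.
module EulerianDowling (R : CommutativeRing c ℓ) (m : CommutativeRing.Carrier R) where

  -- The sum over k ≤ i ≤ n, reindexed by i = k + j; note m ^ 0 = 1# for all m.
  W : ℕ → ℕ → CommutativeRing.Carrier R
  W n k = ∑[ j < suc n ∸ k ]
    (((n C (k ℕ.+ toℕ j)) ℕ.* stirling₂ (k ℕ.+ toℕ j) k) × (m ^ toℕ j))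
    where
    open CommutativeRing R using (semiring)
    open Exp semiring using (_^_)
    open Mult semiring using (_×_)
    open Sum semiring using (sum-syntax)

  R[X] : CommutativeRing _ _
  R[X] = Polynomial.commutativeRing R

  open Polynomial R public using (const; X)
  open CommutativeRing R[X] public using (Carrier; _≈_; _+_; _*_; _-_; 1#)
  open Exp (CommutativeRing.semiring R[X]) public using (_^_)
  open Mult (CommutativeRing.semiring R[X]) public using (_×_)
  open Sum (CommutativeRing.semiring R[X]) using (sum-syntax)
  open PowerSeries R[X] public using (convergent; _⟶_)
  open Determinant R[X] public using (hankelTransform)

  𝒜 : ℕ → Carrier
  𝒜 n = ∑[ k < suc n ]
    ((toℕ k !) × (const (W n (toℕ k)) * (X - 1#) ^ (n ∸ toℕ k)))

  b : ℕ → Carrier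
  b n = X * (n × const m + 1#) - n × (const m - 2 × 1#)

  lam : ℕ → Carrier
  lam n = (n ℕ.^ 2) × (const m * (X - 1#) + 1#)

{-# OPTIONS --safe #-}
module Submission where

-- Let T(n, k) be the weighted count of Motzkin paths of length n from height 0
-- to height k, with level weights b and down weights lam.  Cutting a path at its
-- last up step shows that the continued fraction is Σ T(n, 0) zⁿ, and cutting
-- a path of length i + j after i steps gives
-- T(i + j, 0) = Σ_k T(i, k) λ₁⋯λₖ T(j, k), an LDLᵀ factorisation of the Hankel
-- matrix with T unitriangular.  It remains to see that 𝒜 n = T(n, 0).
-- Put y = x - 1, p = m y and E = (e^{pz} - 1) / p.  The terms
-- k! W_m(n, k) y^{n-k} have the exponential generating function e^{yz} E^k, so
-- 𝒜 has F = e^{yz} / (1 - E).  With G = E / (1 - E) one has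
-- F′ = (y + 1) F + (p + 1) F G and G′ = (1 + G) (1 + (p + 1) G), whence
--   (F Gᵏ)′ = k F Gᵏ⁻¹ + b_k F Gᵏ + (p + 1) (k + 1) F Gᵏ⁺¹,
-- so that F Gᵏ / k! satisfies the recurrence of T.  As the coefficients of
-- F Gᵏ are Σ_j C(j, k) j! W_m(n, j) y^{n-j}, no division is needed.

open import Defs
open import Algebra.Bundles using (CommutativeRing)
open import Data.Fin.Base using (Fin; zero; suc; toℕ; fromℕ<; inject₁; punchIn; punchOut)
open import Data.Fin.Induction using (<-weakInduction)
open import Data.List.Base using (map; upTo; applyUpTo; []; _∷_; _∷ʳ_)
open import Data.List.Properties using (applyUpTo-∷ʳ; map-upTo)
open import Data.Nat.Base as ℕ using (ℕ; zero; suc; _∸_; z≤n; s≤s; _!)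
open import Data.Nat.Combinatorics using (_C_; nC1≡n; k>n⇒nCk≡0; nCk+nC[k+1]≡[n+1]C[k+1])
open import Data.Nat.ListAction using (product)
open import Data.Nat.ListAction.Properties using (sum-++)
open import Data.Product.Base as Product using (_,_; ∃-syntax)
open import Data.Sum.Base using (inj₁; inj₂)
open import Data.Vec.Functional using (updateAt)
open import Data.Vec.Functional.Properties using (updateAt-updates; updateAt-minimal)
open import Function.Base using (_∘_; id)
open import Relation.Binary.PropositionalEquality as ≡ using (_≡_; _≢_)
open import Relation.Nullary using (yes; no; contradiction)

import Algebra.Properties.CommutativeSemigroup as CommutativeSemigroupProperties
import Algebra.Properties.CommutativeSemiring.Exp as CommutativeSemiringExp
import Algebra.Properties.Ring as RingProperties
import Algebra.Properties.Semiring.Exp as Exp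
import Algebra.Properties.Semiring.Mult as Mult
import Algebra.Properties.Semiring.Sum as Sum
import Algebra.Solver.Ring.NaturalCoefficients.Default as Solver
import Data.Fin.Properties as Fin
import Data.Nat.ListAction as ListAction
import Data.Nat.Properties as ℕ
import Data.Nat.Solver as ℕSolver
import Relation.Binary.Reasoning.Setoid as SetoidReasoning

-- Power series arithmetic and the levels of a continued fraction.

module SeriesProperties {c ℓ} (A : CommutativeRing c ℓ) where

  open CommutativeRing A hiding (zero)
  open RingProperties ring using ([y-z]x≈yx-zx; -‿+-comm; //-rightDividesʳ; +-cancelʳ; -0#≈0#)
  open CommutativeSemigroupProperties +-commutativeSemigroup
    using () renaming (interchange to +-interchange)
  open PowerSeries A using (Series; 𝟙; z; convergent; 1/_; 1/-inverseʳ)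
    renaming (_*_ to _⊛_; _-_ to _⊖_; _·_ to _⊙_)
  open SetoidReasoning setoid

  +-minus-interchange : ∀ w x y z → (w - x) + (y - z) ≈ (w + y) - (x + z)
  +-minus-interchange w x y z = begin
    (w - x) + (y - z)       ≈⟨ +-interchange w (- x) y (- z) ⟩
    (w + y) + (- x + - z)   ≈⟨ +-congˡ (-‿+-comm x z) ⟩
    (w + y) - (x + z)       ∎

  infix 4 _≈[_]_

  _≈[_]_ : Series → ℕ → Series → Set ℓ
  f ≈[ d ] g = ∀ i → i ℕ.< d → f i ≈ g i

  tail : Series → Series
  tail f = f ∘ suc

  shift : Series → Series
  shift f zero    = 0#
  shift f (suc n) = f n

  -- The hypotheses are asymmetric because the recursion on the degree strips the constant term of
  -- the first factor and keeps the second one fixed.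
  ⊛-cong : ∀ {f f′ g g′} n → (∀ i → f i ≈ f′ i) → g ≈[ suc n ] g′ →
           (f ⊛ g) n ≈ (f′ ⊛ g′) n
  ⊛-cong zero    e e′ = +-congʳ (*-cong (e 0) (e′ 0 (s≤s z≤n)))
  ⊛-cong (suc n) e e′ = +-cong
    (*-cong (e 0) (e′ (suc n) ℕ.≤-refl))
    (⊛-cong n (e ∘ suc) (λ i i<n → e′ i (ℕ.m≤n⇒m≤1+n i<n)))

  ⊖-⊛ : ∀ f g h n → ((f ⊖ g) ⊛ h) n ≈ (f ⊛ h) n - (g ⊛ h) n
  ⊖-⊛ f g h zero = begin
    (f 0 - g 0) * h 0 + 0#                    ≈⟨ +-identityʳ _ ⟩
    (f 0 - g 0) * h 0                         ≈⟨ [y-z]x≈yx-zx _ _ _ ⟩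
    f 0 * h 0 - g 0 * h 0                     ≈⟨ +-cong (+-identityʳ _) (-‿cong (+-identityʳ _)) ⟨
    (f 0 * h 0 + 0#) - (g 0 * h 0 + 0#)       ∎
  ⊖-⊛ f g h (suc n) = begin
    (f 0 - g 0) * h (suc n) + ((tail f ⊖ tail g) ⊛ h) n
      ≈⟨ +-cong ([y-z]x≈yx-zx _ _ _) (⊖-⊛ (tail f) (tail g) h n) ⟩
    (f 0 * h (suc n) - g 0 * h (suc n)) + ((tail f ⊛ h) n - (tail g ⊛ h) n)
      ≈⟨ +-minus-interchange _ _ _ _ ⟩
    (f ⊛ h) (suc n) - (g ⊛ h) (suc n) ∎

  ⊙-⊛ : ∀ a f g n → ((a ⊙ f) ⊛ g) n ≈ a * (f ⊛ g) n
  ⊙-⊛ a f g zero = begin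
    a * f 0 * g 0 + 0#     ≈⟨ +-cong (*-assoc a _ _) (sym (zeroʳ a)) ⟩
    a * (f 0 * g 0) + a * 0#   ≈⟨ distribˡ a _ _ ⟨
    a * (f 0 * g 0 + 0#)   ∎
  ⊙-⊛ a f g (suc n) = begin
    a * f 0 * g (suc n) + ((a ⊙ tail f) ⊛ g) n
      ≈⟨ +-cong (*-assoc a _ _) (⊙-⊛ a (tail f) g n) ⟩
    a * (f 0 * g (suc n)) + a * (tail f ⊛ g) n
      ≈⟨ distribˡ a _ _ ⟨
    a * (f ⊛ g) (suc n) ∎

  +-⊛ : ∀ f g h n → ((λ i → f i + g i) ⊛ h) n ≈ (f ⊛ h) n + (g ⊛ h) n
  +-⊛ f g h zero = begin
    (f 0 + g 0) * h 0 + 0#                 ≈⟨ +-cong (distribʳ _ _ _) (sym (+-identityʳ 0#)) ⟩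
    f 0 * h 0 + g 0 * h 0 + (0# + 0#)      ≈⟨ +-interchange _ _ _ _ ⟩
    (f 0 * h 0 + 0#) + (g 0 * h 0 + 0#)    ∎
  +-⊛ f g h (suc n) = begin
    (f 0 + g 0) * h (suc n) + ((λ i → f (suc i) + g (suc i)) ⊛ h) n
      ≈⟨ +-cong (distribʳ _ _ _) (+-⊛ (tail f) (tail g) h n) ⟩
    (f 0 * h (suc n) + g 0 * h (suc n)) + ((tail f ⊛ h) n + (tail g ⊛ h) n)
      ≈⟨ +-interchange _ _ _ _ ⟩
    (f ⊛ h) (suc n) + (g ⊛ h) (suc n) ∎

  zero-⊛ : ∀ f g n → (∀ i → f i ≈ 0#) → (f ⊛ g) n ≈ 0#
  zero-⊛ f g zero    f≈0 = trans (+-identityʳ _) (trans (*-congʳ (f≈0 0)) (zeroˡ _))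
  zero-⊛ f g (suc n) f≈0 = begin
    f 0 * g (suc n) + (tail f ⊛ g) n   ≈⟨ +-cong (*-congʳ (f≈0 0)) (zero-⊛ (tail f) g n (f≈0 ∘ suc)) ⟩
    0# * g (suc n) + 0#                ≈⟨ +-identityʳ _ ⟩
    0# * g (suc n)                     ≈⟨ zeroˡ _ ⟩
    0#                                 ∎

  𝟙-⊛ : ∀ f n → (𝟙 ⊛ f) n ≈ f n
  𝟙-⊛ f zero    = trans (+-identityʳ _) (*-identityˡ _)
  𝟙-⊛ f (suc n) = begin
    1# * f (suc n) + (tail 𝟙 ⊛ f) n   ≈⟨ +-cong (*-identityˡ _) (zero-⊛ (tail 𝟙) f n (λ _ → refl)) ⟩
    f (suc n) + 0#                    ≈⟨ +-identityʳ _ ⟩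
    f (suc n)                         ∎

  z-⊛ : ∀ f n → (z ⊛ f) n ≈ shift f n
  z-⊛ f zero    = trans (+-identityʳ _) (zeroˡ _)
  z-⊛ f (suc n) = begin
    0# * f (suc n) + (tail z ⊛ f) n
      ≈⟨ +-cong (zeroˡ _) (⊛-cong {tail z} {𝟙} {f} n (λ { zero → refl ; (suc _) → refl }) (λ _ _ → refl)) ⟩
    0# + (𝟙 ⊛ f) n   ≈⟨ +-identityˡ _ ⟩
    (𝟙 ⊛ f) n        ≈⟨ 𝟙-⊛ f n ⟩
    f n              ∎

  ⊛-assoc : ∀ f g h n → ((f ⊛ g) ⊛ h) n ≈ (f ⊛ (g ⊛ h)) n
  ⊛-assoc f g h zero = begin
    (f 0 * g 0 + 0#) * h 0 + 0#   ≈⟨ +-congʳ (*-congʳ (+-identityʳ _)) ⟩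
    f 0 * g 0 * h 0 + 0#          ≈⟨ +-congʳ (*-assoc _ _ _) ⟩
    f 0 * (g 0 * h 0) + 0#        ≈⟨ +-congʳ (*-congˡ (+-identityʳ _)) ⟨
    f 0 * (g 0 * h 0 + 0#) + 0#   ∎
  ⊛-assoc f g h (suc n) = begin
    -- By definition `tail (f ⊛ g)` is `f 0 ⊙ tail g` plus `tail f ⊛ g`, coefficient by coefficient,
    -- so `+-⊛` applies directly.
    (f 0 * g 0 + 0#) * h (suc n) + (tail (f ⊛ g) ⊛ h) n
      ≈⟨ +-cong (trans (*-congʳ (+-identityʳ _)) (*-assoc _ _ _))
                (+-⊛ (f 0 ⊙ tail g) (tail f ⊛ g) h n) ⟩
    f 0 * (g 0 * h (suc n)) + (((f 0 ⊙ tail g) ⊛ h) n + ((tail f ⊛ g) ⊛ h) n)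
      ≈⟨ +-congˡ (+-cong (⊙-⊛ (f 0) (tail g) h n) (⊛-assoc (tail f) g h n)) ⟩
    f 0 * (g 0 * h (suc n)) + (f 0 * (tail g ⊛ h) n + (tail f ⊛ (g ⊛ h)) n)
      ≈⟨ +-assoc _ _ _ ⟨
    f 0 * (g 0 * h (suc n)) + f 0 * (tail g ⊛ h) n + (tail f ⊛ (g ⊛ h)) n
      ≈⟨ +-congʳ (distribˡ _ _ _) ⟨
    (f ⊛ (g ⊛ h)) (suc n) ∎

  shift-cong : ∀ {f g} n → f ≈[ n ] g → shift f n ≈ shift g n
  shift-cong zero    e = refl
  shift-cong (suc n) e = e n ℕ.≤-refl

  ⊛-shift : ∀ f g n → (f ⊛ shift g) n ≈ shift (f ⊛ g) n
  ⊛-shift f g zero          = trans (+-identityʳ _) (zeroʳ _)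
  ⊛-shift f g (suc zero)    = +-congˡ (trans (+-identityʳ _) (zeroʳ _))
  ⊛-shift f g (suc (suc n)) = +-congˡ (⊛-shift (tail f) g (suc n))

  -- Coefficient i of f g is g i plus a combination of lower coefficients of g, so agreement of the
  -- products propagates upwards. The truncated form is needed because convergents match the moments
  -- only up to a degree.
  ⊛-cancelˡ : ∀ f {g h} → f 0 ≈ 1# → ∀ d → f ⊛ g ≈[ d ] f ⊛ h → g ≈[ d ] h
  ⊛-cancelˡ f {g} {h} f₀≈1 (suc d) e i (s≤s i≤d)
    with ih ← ⊛-cancelˡ f f₀≈1 d (λ j j<d → e j (ℕ.m≤n⇒m≤1+n j<d))
       | ℕ.m≤n⇒m<n∨m≡n i≤d
  ... | inj₁ i<d    = ih i i<d
  ... | inj₂ ≡.refl = begin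
    g i          ≈⟨ *-identityˡ _ ⟨
    1# * g i     ≈⟨ *-congʳ f₀≈1 ⟨
    f 0 * g i    ≈⟨ leading i ih (e i ℕ.≤-refl) ⟩
    f 0 * h i    ≈⟨ *-congʳ f₀≈1 ⟩
    1# * h i     ≈⟨ *-identityˡ _ ⟩
    h i          ∎
    where
    leading : ∀ i → g ≈[ i ] h → (f ⊛ g) i ≈ (f ⊛ h) i → f 0 * g i ≈ f 0 * h i
    leading zero    _  eq = +-cancelʳ _ _ _ eq
    leading (suc i) ih eq = +-cancelʳ _ _ _ (trans eq
      (+-congˡ (⊛-cong {tail f} {tail f} {h} {g} i (λ _ → refl) (λ j j≤i → sym (ih j j≤i)))))

  -- Level k of the continued fraction has denominator 1 - β z - γ z² K with K
  -- the fraction of level k + 1.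
  denominator : Carrier → Carrier → Series → Series
  denominator β γ K = 𝟙 ⊖ β ⊙ z ⊖ γ ⊙ (z ⊛ z ⊛ K)

  denominator-0 : ∀ β γ K → denominator β γ K 0 ≈ 1#
  denominator-0 β γ K = begin
    1# - β * 0# - γ * ((0# * 0# + 0#) * K 0 + 0#)
      ≈⟨ +-cong (+-congˡ (-‿cong (zeroʳ β))) (-‿cong (*-congˡ z²K-0)) ⟩
    1# - 0# - γ * 0#   ≈⟨ +-congˡ (-‿cong (zeroʳ γ)) ⟩
    1# - 0# - 0#       ≈⟨ x-0≈x _ ⟩
    1# - 0#            ≈⟨ x-0≈x _ ⟩
    1#                 ∎
    where
    x-0≈x : ∀ x → x - 0# ≈ x
    x-0≈x x = trans (+-congˡ -0#≈0#) (+-identityʳ x)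
    z²K-0 : (0# * 0# + 0#) * K 0 + 0# ≈ 0#
    z²K-0 = begin
      (0# * 0# + 0#) * K 0 + 0#   ≈⟨ +-identityʳ _ ⟩
      (0# * 0# + 0#) * K 0        ≈⟨ *-congʳ (+-identityʳ _) ⟩
      0# * 0# * K 0               ≈⟨ *-congʳ (zeroˡ _) ⟩
      0# * K 0                    ≈⟨ zeroˡ _ ⟩
      0#                          ∎

  -- Multiplication by z is `shift`, so an equation between series with this denominator becomes a
  -- three-term recurrence of coefficients.
  denominator-⊛ : ∀ β γ K f n →
    (denominator β γ K ⊛ f) n ≈ f n - β * shift f n - γ * shift (shift (K ⊛ f)) n
  denominator-⊛ β γ K f n = begin
    (denominator β γ K ⊛ f) n
      ≈⟨ ⊖-⊛ (𝟙 ⊖ β ⊙ z) (γ ⊙ (z ⊛ z ⊛ K)) f n ⟩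
    ((𝟙 ⊖ β ⊙ z) ⊛ f) n - ((γ ⊙ (z ⊛ z ⊛ K)) ⊛ f) n
      ≈⟨ +-cong (⊖-⊛ 𝟙 (β ⊙ z) f n) (-‿cong (⊙-⊛ γ (z ⊛ z ⊛ K) f n)) ⟩
    (𝟙 ⊛ f) n - ((β ⊙ z) ⊛ f) n - γ * (z ⊛ z ⊛ K ⊛ f) n
      ≈⟨ +-cong (+-cong (𝟙-⊛ f n) (-‿cong (trans (⊙-⊛ β z f n) (*-congˡ (z-⊛ f n)))))
                (-‿cong (*-congˡ z²Kf)) ⟩
    f n - β * shift f n - γ * shift (shift (K ⊛ f)) n ∎
    where
    z²Kf : (z ⊛ z ⊛ K ⊛ f) n ≈ shift (shift (K ⊛ f)) n
    z²Kf = begin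
      (z ⊛ z ⊛ K ⊛ f) n          ≈⟨ ⊛-assoc (z ⊛ z) K f n ⟩
      (z ⊛ z ⊛ (K ⊛ f)) n        ≈⟨ ⊛-assoc z z (K ⊛ f) n ⟩
      (z ⊛ (z ⊛ (K ⊛ f))) n      ≈⟨ z-⊛ (z ⊛ (K ⊛ f)) n ⟩
      shift (z ⊛ (K ⊛ f)) n      ≈⟨ shift-cong n (λ i _ → z-⊛ (K ⊛ f) i) ⟩
      shift (shift (K ⊛ f)) n    ∎

  -- Solves the path recurrence for its up-step term `w`: `x` is the level term and `t` expresses
  -- the down-step term `y` through the next continued fraction.
  cancel-terms : ∀ {v t} w x y → v ≈ w + x + y → y ≈ t → v - x - t ≈ w
  cancel-terms {v} {t} w x y v≈ y≈t = begin
    v - x - t               ≈⟨ +-cong (+-congʳ v≈) (-‿cong (sym y≈t)) ⟩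
    w + x + y - x - y       ≈⟨ +-congʳ (+-congʳ (x+y+z≈x+z+y w x y)) ⟩
    w + y + x - x - y       ≈⟨ +-congʳ (//-rightDividesʳ x (w + y)) ⟩
    w + y - y               ≈⟨ //-rightDividesʳ y w ⟩
    w                       ∎
    where
    x+y+z≈x+z+y : ∀ x y z → x + y + z ≈ x + z + y
    x+y+z≈x+z+y x y z = trans (+-assoc x y z) (trans (+-congˡ (+-comm y z)) (sym (+-assoc x z y)))

  -- F k is the generating series of the weighted Motzkin paths ending at
  -- height k; cutting such a path at its last step from height 0 to height 1
  -- gives F 1 = z K′ (F 0), where K′ is the continued fraction of height 1, whose
  -- denominator has the coefficients b 0 and lam 1.
  convergent-F : ∀ N (b lam : ℕ → Carrier) (F : ℕ → Series) →
    (∀ k → F (suc k) 0 ≈ 0#) →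
    (∀ k n → F (suc k) (suc n) ≈ F k n + b k * F (suc k) n + lam (suc k) * F (suc (suc k)) n) →
    F 1 ≈[ suc N ] shift (convergent b lam N ⊛ F 0)
  convergent-F zero    b lam F F₀ Fₛ zero (s≤s z≤n) = F₀ 0
  convergent-F (suc N) b lam F F₀ Fₛ =
    -- Both sides are compared after multiplication by `D`: the recurrence turns `D ⊛ F 1` into the
    -- shift of `F 0`, and on the right `D` cancels `K′`.
    ⊛-cancelˡ D (denominator-0 (b 0) (lam 1) K) (suc (suc N)) λ n n<2+N → begin
      (D ⊛ F 1) n                             ≈⟨ D⊛F₁ n n<2+N ⟩
      shift (F 0) n                           ≈⟨ shift-cong n (λ i _ → K′-inverse i) ⟨
      shift (D ⊛ (K′ ⊛ F 0)) n                ≈⟨ ⊛-shift D (K′ ⊛ F 0) n ⟨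
      (D ⊛ shift (K′ ⊛ F 0)) n                ∎
    where
    K K′ D : Series
    K  = convergent (b ∘ suc) (lam ∘ suc) N
    D  = denominator (b 0) (lam 1) K
    K′ = 1/ D

    K′-inverse : ∀ n → (D ⊛ (K′ ⊛ F 0)) n ≈ F 0 n
    K′-inverse n = begin
      (D ⊛ (K′ ⊛ F 0)) n   ≈⟨ ⊛-assoc D K′ (F 0) n ⟨
      (D ⊛ K′ ⊛ F 0) n
        ≈⟨ ⊛-cong {g = F 0} n (1/-inverseʳ D (denominator-0 (b 0) (lam 1) K)) (λ _ _ → refl) ⟩
      (𝟙 ⊛ F 0) n          ≈⟨ 𝟙-⊛ (F 0) n ⟩
      F 0 n                ∎

    D⊛F₁ : ∀ n → n ℕ.< suc (suc N) → (D ⊛ F 1) n ≈ shift (F 0) n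
    D⊛F₁ zero    _          = trans (denominator-⊛ (b 0) (lam 1) K (F 1) 0)
      (cancel-terms 0# (b 0 * 0#) (lam 1 * 0#) 0-terms refl)
      where
      0-terms : F 1 0 ≈ 0# + b 0 * 0# + lam 1 * 0#
      0-terms = begin
        F 1 0                        ≈⟨ F₀ 0 ⟩
        0#                           ≈⟨ +-identityʳ _ ⟨
        0# + 0#                      ≈⟨ +-cong (+-identityʳ 0#) refl ⟨
        0# + 0# + 0#                 ≈⟨ +-cong (+-congˡ (zeroʳ _)) (zeroʳ _) ⟨
        0# + b 0 * 0# + lam 1 * 0#   ∎
    D⊛F₁ (suc n) (s≤s n<1+N) = trans (denominator-⊛ (b 0) (lam 1) K (F 1) (suc n))
      (cancel-terms (F 0 n) (b 0 * F 1 n) (lam 1 * F 2 n) (Fₛ 0 n)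
        -- One height up, the induction hypothesis reaches one degree less than the claim; the outer
        -- `shift` of `denominator-⊛` makes up for it.
        (*-congˡ (convergent-F N (b ∘ suc) (lam ∘ suc) (F ∘ suc) (F₀ ∘ suc) (Fₛ ∘ suc) n n<1+N)))

-- Determinants: alternation, column operations and triangular factorisations.

-- Ensures that a minor retaining two equal adjacent columns still has them side by side, so that
-- induction applies to it.
punchIn-adjacent : ∀ {n} (j : Fin (2 ℕ.+ n)) (p : Fin (suc n)) →
  j ≢ inject₁ p → j ≢ suc p →
  ∃[ q ] (punchIn j (inject₁ q) ≡ inject₁ p Product.× punchIn j (suc q) ≡ suc p)
punchIn-adjacent         zero          zero    j≢p _   = contradiction ≡.refl j≢p
punchIn-adjacent         zero          (suc p) _   _   = p , ≡.refl , ≡.refl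
punchIn-adjacent         (suc zero)    zero    _   j≢p = contradiction ≡.refl j≢p
punchIn-adjacent {suc n} (suc (suc j)) zero    _   _   = zero , ≡.refl , ≡.refl
punchIn-adjacent {suc n} (suc j)       (suc p) j≢p j≢p′
  with q , e , e′ ← punchIn-adjacent j p (j≢p ∘ ≡.cong suc) (j≢p′ ∘ ≡.cong suc)
  = suc q , ≡.cong suc e , ≡.cong suc e′

module DeterminantProperties {c ℓ} (A : CommutativeRing c ℓ) where

  open CommutativeRing A hiding (zero)
  open RingProperties ring using (-1*x≈-x; -‿distribˡ-*)
  open Exp semiring using (_^_)
  open Sum semiring
  open CommutativeSemigroupProperties *-commutativeSemigroup using (x∙yz≈y∙xz)
  open Determinant A using (det)
  open SetoidReasoning setoid

  Matrix : ℕ → Set c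
  Matrix n = Fin n → Fin n → Carrier

  minor : ∀ {n} → Matrix (suc n) → Fin (suc n) → Matrix n
  minor M j i k = M (suc i) (punchIn j k)

  laplaceTerm : ∀ {n} → Matrix (suc n) → Fin (suc n) → Carrier
  laplaceTerm M j = (- 1#) ^ toℕ j * (M zero j * det (minor M j))

  det-cong : ∀ {n} {M N : Matrix n} → (∀ i j → M i j ≈ N i j) → det M ≈ det N
  det-cong {zero}  e = refl
  det-cong {suc n} e = sum-cong-≋ λ j →
    *-congˡ {(- 1#) ^ toℕ j} (*-cong (e zero j) (det-cong (λ i k → e (suc i) (punchIn j k))))

  -- Laplace expansion along the first row: in the term of column `p` the entry splits and the
  -- minors agree, and in any other term the minor splits by induction. Relating three matrices
  -- entrywise makes the hypotheses pass to minors.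
  det-column : ∀ {n} {L M N : Matrix n} (p : Fin n) (a : Carrier) →
    (∀ i → L i p ≈ M i p + a * N i p) →
    (∀ i k → k ≢ p → L i k ≈ M i k) →
    (∀ i k → k ≢ p → L i k ≈ N i k) →
    det L ≈ det M + a * det N
  det-column {suc n} {L} {M} {N} p a Lp L≈M L≈N = begin
    sum (laplaceTerm L)                               ≈⟨ sum-cong-≋ term ⟩
    ∑[ j < suc n ] (laplaceTerm M j + a * laplaceTerm N j)
      ≈⟨ ∑-distrib-+ (laplaceTerm M) (λ j → a * laplaceTerm N j) ⟩
    det M + ∑[ j < suc n ] (a * laplaceTerm N j)      ≈⟨ +-congˡ (*-distribˡ-sum a (laplaceTerm N)) ⟨
    det M + a * det N                                 ∎
    where
    distrib-scaled : ∀ s x y → s * (x + a * y) ≈ s * x + a * (s * y)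
    distrib-scaled s x y = trans (distribˡ s x (a * y)) (+-congˡ (x∙yz≈y∙xz s a y))

    scaled : ∀ {x y z} s → x ≈ y + a * z → s * x ≈ s * y + a * (s * z)
    scaled s e = trans (*-congˡ e) (distrib-scaled s _ _)

    term : ∀ j → laplaceTerm L j ≈ laplaceTerm M j + a * laplaceTerm N j
    term j with j Fin.≟ p
    ... | yes ≡.refl = scaled ((- 1#) ^ toℕ j) (begin
      L zero j * det (minor L j)
        ≈⟨ *-congʳ (Lp zero) ⟩
      (M zero j + a * N zero j) * det (minor L j)
        ≈⟨ distribʳ _ _ _ ⟩
      M zero j * det (minor L j) + a * N zero j * det (minor L j)
        ≈⟨ +-cong (*-congˡ (det-cong λ i k → L≈M (suc i) _ (Fin.punchInᵢ≢i j k)))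
                  (trans (*-assoc _ _ _) (*-congˡ (*-congˡ
                    (det-cong λ i k → L≈N (suc i) _ (Fin.punchInᵢ≢i j k))))) ⟩
      M zero j * det (minor M j) + a * (N zero j * det (minor N j)) ∎)
    ... | no j≢p = scaled ((- 1#) ^ toℕ j) (begin
      L zero j * det (minor L j)
        ≈⟨ scaled (L zero j) (det-column q a
             (λ i → ≡.subst (λ k → L (suc i) k ≈ M (suc i) k + a * N (suc i) k) (≡.sym jq≡p) (Lp (suc i)))
             (λ i k k≢q → L≈M (suc i) _ (jk≢p k≢q))
             (λ i k k≢q → L≈N (suc i) _ (jk≢p k≢q))) ⟩
      L zero j * det (minor M j) + a * (L zero j * det (minor N j))
        ≈⟨ +-cong (*-congʳ (L≈M zero j j≢p)) (*-congˡ (*-congʳ (L≈N zero j j≢p))) ⟩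
      M zero j * det (minor M j) + a * (N zero j * det (minor N j)) ∎)
      where
      q : Fin n
      q = punchOut j≢p
      jq≡p : punchIn j q ≡ p
      jq≡p = Fin.punchIn-punchOut j≢p
      jk≢p : ∀ {k} → k ≢ q → punchIn j k ≢ p
      jk≢p k≢q jk≡p = k≢q (Fin.punchIn-injective j _ _ (≡.trans jk≡p (≡.sym jq≡p)))

  sum-zero : ∀ {n} {f : Fin n → Carrier} → (∀ j → f j ≈ 0#) → sum f ≈ 0#
  sum-zero {n} f≈0 = trans (sum-cong-≋ f≈0) (sum-replicate-zero n)

  sum-adjacent : ∀ {n} (f : Fin (suc n) → Carrier) (p : Fin n) →
    f (inject₁ p) + f (suc p) ≈ 0# →
    (∀ j → j ≢ inject₁ p → j ≢ suc p → f j ≈ 0#) →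
    sum f ≈ 0#
  sum-adjacent f zero    pair rest = begin
    f zero + (f (suc zero) + sum (λ j → f (suc (suc j))))
      ≈⟨ +-assoc _ _ _ ⟨
    f zero + f (suc zero) + sum (λ j → f (suc (suc j)))
      ≈⟨ +-cong pair (sum-zero λ j → rest (suc (suc j)) (λ ()) (λ ())) ⟩
    0# + 0#   ≈⟨ +-identityʳ _ ⟩
    0#        ∎
  sum-adjacent f (suc p) pair rest = begin
    f zero + sum (f ∘ suc)
      ≈⟨ +-cong (rest zero (λ ()) (λ ())) (sum-adjacent (f ∘ suc) p pair
           λ j j≢p j≢p′ → rest (suc j) (j≢p ∘ Fin.suc-injective) (j≢p′ ∘ Fin.suc-injective)) ⟩
    0# + 0#   ≈⟨ +-identityʳ _ ⟩
    0#        ∎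

  punchIn-≈ : ∀ {n} (f : Fin (suc n) → Carrier) (p : Fin n) → f (inject₁ p) ≈ f (suc p) →
    ∀ k → f (punchIn (inject₁ p) k) ≈ f (punchIn (suc p) k)
  punchIn-≈ f zero    e zero    = sym e
  punchIn-≈ f zero    e (suc k) = refl
  punchIn-≈ f (suc p) e zero    = refl
  punchIn-≈ f (suc p) e (suc k) = punchIn-≈ (f ∘ suc) p e k

  -- The Laplace terms of the two equal columns have equal minors and opposite signs, hence cancel.
  -- Every other minor contains both columns, still adjacent, and vanishes by induction.
  det-adjacent : ∀ {n} (M : Matrix (suc n)) (p : Fin n) →
    (∀ i → M i (inject₁ p) ≈ M i (suc p)) → det M ≈ 0#
  det-adjacent {suc n} M p e = sum-adjacent (laplaceTerm M) p pair rest
    where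
    pair : laplaceTerm M (inject₁ p) + laplaceTerm M (suc p) ≈ 0#
    pair = begin
      laplaceTerm M (inject₁ p) + laplaceTerm M (suc p)
        ≈⟨ +-cong
             (*-cong (reflexive (≡.cong ((- 1#) ^_) (Fin.toℕ-inject₁ p)))
                     (*-cong (e zero) (det-cong λ i → punchIn-≈ (M (suc i)) p (e (suc i)))))
             (trans (*-congʳ (-1*x≈-x _)) (sym (-‿distribˡ-* _ _))) ⟩
      x - x   ≈⟨ -‿inverseʳ _ ⟩
      0#      ∎
      where x = (- 1#) ^ toℕ p * (M zero (suc p) * det (minor M (suc p)))
    rest : ∀ j → j ≢ inject₁ p → j ≢ suc p → laplaceTerm M j ≈ 0#
    rest j j≢p j≢p′ with q , e₁ , e₂ ← punchIn-adjacent j p j≢p j≢p′ = begin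
      (- 1#) ^ toℕ j * (M zero j * det (minor M j))
        ≈⟨ *-congˡ (*-congˡ (det-adjacent (minor M j) q λ i → begin
             M (suc i) (punchIn j (inject₁ q))   ≡⟨ ≡.cong (M (suc i)) e₁ ⟩
             M (suc i) (inject₁ p)               ≈⟨ e (suc i) ⟩
             M (suc i) (suc p)                   ≡⟨ ≡.cong (M (suc i)) e₂ ⟨
             M (suc i) (punchIn j (suc q))       ∎)) ⟩
      (- 1#) ^ toℕ j * (M zero j * 0#)   ≈⟨ *-congˡ (zeroʳ _) ⟩
      (- 1#) ^ toℕ j * 0#                ≈⟨ zeroʳ _ ⟩
      0#                                 ∎

  infixl 6 _[_≔_]

  _[_≔_] : ∀ {n} → Matrix n → Fin n → (Fin n → Carrier) → Matrix n
  (M [ p ≔ v ]) i = updateAt (M i) p (λ _ → v i)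

  ≔-updated : ∀ {n} (M : Matrix n) p v i → (M [ p ≔ v ]) i p ≈ v i
  ≔-updated M p v i = reflexive (updateAt-updates p (M i))

  ≔-minimal : ∀ {n} (M : Matrix n) p v i k → k ≢ p → (M [ p ≔ v ]) i k ≈ M i k
  ≔-minimal M p v i k k≢p = reflexive (updateAt-minimal k p (M i) k≢p)

  det-+-column : ∀ {n} (M : Matrix n) (p : Fin n) (a : Carrier) (v : Fin n → Carrier) →
    det (M [ p ≔ (λ i → M i p + a * v i) ]) ≈ det M + a * det (M [ p ≔ v ])
  det-+-column M p a v = det-column p a
    (λ i → trans (≔-updated M p (λ i → M i p + a * v i) i) (+-congˡ (*-congˡ (sym (≔-updated M p v i)))))
    (λ i k → ≔-minimal M p (λ i → M i p + a * v i) i k)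
    (λ i k k≢p → trans (≔-minimal M p (λ i → M i p + a * v i) i k k≢p) (sym (≔-minimal M p v i k k≢p)))

  det-+-column-0 : ∀ {n} (M : Matrix n) (p : Fin n) (a : Carrier) (v : Fin n → Carrier) →
    det (M [ p ≔ v ]) ≈ 0# → det (M [ p ≔ (λ i → M i p + a * v i) ]) ≈ det M
  det-+-column-0 M p a v e = begin
    det (M [ p ≔ (λ i → M i p + a * v i) ])   ≈⟨ det-+-column M p a v ⟩
    det M + a * det (M [ p ≔ v ])             ≈⟨ +-congˡ (*-congˡ e) ⟩
    det M + a * 0#                            ≈⟨ +-congˡ (zeroʳ a) ⟩
    det M + 0#                                ≈⟨ +-identityʳ _ ⟩
    det M                                     ∎

  det-equal-zeroth : ∀ {n} (p : Fin n) (M : Matrix (suc n)) →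
    (∀ i → M i zero ≈ M i (suc p)) → det M ≈ 0#
  det-equal-zeroth {suc n} =
    <-weakInduction (λ p → ∀ M → (∀ i → M i zero ≈ M i (suc p)) → det M ≈ 0#)
      (λ M → det-adjacent M zero) step
    where
    -- With w, v the columns q + 1, q + 2 (and v the column 0 as well), adding
    -- w to v and then v to w makes these two adjacent columns both w + v.
    step : ∀ q →
      (∀ (M : Matrix (2 ℕ.+ n)) → (∀ i → M i zero ≈ M i (suc (inject₁ q))) → det M ≈ 0#) →
      ∀ M → (∀ i → M i zero ≈ M i (suc (suc q))) → det M ≈ 0#
    step q ih M M₀≈Mⱼ = begin
      det M    ≈⟨ det-+-column-0 M j 1# w (det-adjacent (M [ j ≔ w ]) (suc q) w-twice) ⟨
      det M₁   ≈⟨ det-+-column-0 M₁ i 1# v (ih (M₁ [ i ≔ v ]) v-twice) ⟨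
      det M₂   ≈⟨ det-adjacent M₂ (suc q) w+v-twice ⟩
      0#       ∎
      where
      i j : Fin (2 ℕ.+ n)
      i = inject₁ (suc q)
      j = suc (suc q)
      i≢j : i ≢ j
      i≢j e = ℕ.1+n≢n (≡.trans (≡.cong toℕ (≡.sym e)) (Fin.toℕ-inject₁ (suc q)))
      v w v+w w+v : Fin (2 ℕ.+ n) → Carrier
      v k = M k zero
      w k = M k i
      M₁ M₂ : Matrix (2 ℕ.+ n)
      v+w k = M k j + 1# * w k
      M₁ = M [ j ≔ v+w ]
      w+v k = M₁ k i + 1# * v k
      M₂ = M₁ [ i ≔ w+v ]

      w-twice : ∀ k → (M [ j ≔ w ]) k i ≈ (M [ j ≔ w ]) k j
      w-twice k = trans (≔-minimal M j w k i i≢j) (sym (≔-updated M j w k))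

      v-twice : ∀ k → (M₁ [ i ≔ v ]) k zero ≈ (M₁ [ i ≔ v ]) k i
      v-twice k = sym (≔-updated M₁ i v k)

      w+v-twice : ∀ k → M₂ k i ≈ M₂ k j
      w+v-twice k = begin
        M₂ k i                    ≈⟨ ≔-updated M₁ i w+v k ⟩
        M₁ k i + 1# * v k         ≈⟨ +-cong (≔-minimal M j v+w k i i≢j) (*-identityˡ _) ⟩
        w k + v k                 ≈⟨ +-comm _ _ ⟩
        v k + w k                 ≈⟨ +-cong (M₀≈Mⱼ k) (sym (*-identityˡ _)) ⟩
        M k j + 1# * w k          ≈⟨ ≔-updated M j v+w k ⟨
        M₁ k j                    ≈⟨ ≔-minimal M₁ i w+v k j (i≢j ∘ ≡.sym) ⟨
        M₂ k j                    ∎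

  addZeroth : ∀ {n} → (Fin n → Carrier) → Matrix (suc n) → Matrix (suc n)
  addZeroth r M i zero    = M i zero
  addZeroth r M i (suc j) = M i (suc j) + r j * M i zero

  -- Column operations are performed one at a time; each changes the determinant by a multiple of
  -- one whose column 0 is repeated.
  det-addZeroth : ∀ {n} (r : Fin n → Carrier) (M : Matrix (suc n)) →
    det (addZeroth r M) ≈ det M
  det-addZeroth {n} r M = supported n r λ j n≤j → contradiction (Fin.toℕ<n j) (ℕ.≤⇒≯ n≤j)
    where
    -- Induction on a bound `p` from which `r` vanishes; a step clears entry p - 1 of `r`, and p = 0
    -- leaves the matrix unchanged.
    supported : ∀ p r → (∀ j → p ℕ.≤ toℕ j → r j ≈ 0#) → det (addZeroth r M) ≈ det M
    supported zero    r r≈0 = det-cong {M = addZeroth r M} {N = M} λ where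
      i zero    → refl
      i (suc j) → trans (+-congˡ (trans (*-congʳ (r≈0 j z≤n)) (zeroˡ _))) (+-identityʳ _)
    supported (suc p) r r≈0 with p ℕ.<? n
    ... | no  p≮n = supported p r λ j p≤j → contradiction (ℕ.≤-<-trans p≤j (Fin.toℕ<n j)) p≮n
    ... | yes p<n = begin
      det (addZeroth r M)             ≈⟨ det-cong split ⟩
      det (M′ [ suc q ≔ updated ])    ≈⟨ det-+-column-0 M′ (suc q) (r q) v
                                           (det-equal-zeroth q (M′ [ suc q ≔ v ])
                                             λ i → sym (≔-updated M′ (suc q) v i)) ⟩
      det M′                          ≈⟨ supported p r′ r′≈0 ⟩
      det M                           ∎
      where
      q : Fin n
      q = fromℕ< p<n
      r′ : Fin n → Carrier
      r′ = updateAt r q (λ _ → 0#)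
      M′ : Matrix (suc n)
      M′ = addZeroth r′ M
      v updated : Fin (suc n) → Carrier
      v i = M i zero
      updated i = M′ i (suc q) + r q * v i

      r′≈0 : ∀ j → p ℕ.≤ toℕ j → r′ j ≈ 0#
      r′≈0 j p≤j with j Fin.≟ q
      ... | yes ≡.refl = reflexive (updateAt-updates j r)
      ... | no  j≢q    = trans (reflexive (updateAt-minimal j q r j≢q))
        (r≈0 j (ℕ.≤∧≢⇒< p≤j λ p≡j → j≢q (Fin.toℕ-injective
          (≡.trans (≡.sym p≡j) (≡.sym (Fin.toℕ-fromℕ< p<n))))))

      split : ∀ i j → addZeroth r M i j ≈ (M′ [ suc q ≔ updated ]) i j
      split i zero    = refl
      split i (suc j) with j Fin.≟ q
      ... | no  j≢q    = begin
        M i (suc j) + r j * M i zero           ≡⟨ ≡.cong (λ x → M i (suc j) + x * M i zero)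
                                                         (updateAt-minimal j q r j≢q) ⟨
        M′ i (suc j)                           ≈⟨ ≔-minimal M′ (suc q) updated i (suc j)
                                                    (j≢q ∘ Fin.suc-injective) ⟨
        (M′ [ suc q ≔ updated ]) i (suc j)     ∎
      ... | yes ≡.refl = begin
        M i (suc j) + r j * M i zero           ≈⟨ +-congʳ (+-identityʳ _) ⟨
        M i (suc j) + 0# + r j * M i zero      ≈⟨ +-congʳ (+-congˡ (zeroˡ _)) ⟨
        M i (suc j) + 0# * M i zero + r j * M i zero
          ≡⟨ ≡.cong (λ x → M i (suc j) + x * M i zero + r j * M i zero) (updateAt-updates j r) ⟨
        M′ i (suc j) + r j * M i zero          ≈⟨ ≔-updated M′ (suc q) updated i ⟨
        (M′ [ suc q ≔ updated ]) i (suc j)     ∎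

  det-zero-row : ∀ {n} (M : Matrix (suc n)) → (∀ j → M zero (suc j) ≈ 0#) →
    det M ≈ M zero zero * det (λ i j → M (suc i) (suc j))
  det-zero-row {n} M e = begin
    1# * (M zero zero * det (minor M zero)) + ∑[ j < n ] laplaceTerm M (suc j)
      ≈⟨ +-cong (*-identityˡ _) (sum-zero λ j → trans
           (*-congˡ (trans (*-congʳ (e j)) (zeroˡ _))) (zeroʳ _)) ⟩
    M zero zero * det (minor M zero) + 0#   ≈⟨ +-identityʳ _ ⟩
    M zero zero * det (minor M zero)        ∎

  ∏ : ℕ → (ℕ → Carrier) → Carrier
  ∏ zero    f = 1#
  ∏ (suc n) f = f 0 * ∏ n (f ∘ suc)

  ∏-cong : ∀ n {f g : ℕ → Carrier} → (∀ k → f k ≈ g k) → ∏ n f ≈ ∏ n g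
  ∏-cong zero    e = refl
  ∏-cong (suc n) e = *-cong (e 0) (∏-cong n (e ∘ suc))

  -- Elimination replaces multiplicativity of the determinant. Column 0 of the product is column 0
  -- of `L`, and the k = 0 summand of column j + 1 is a multiple of it. Once these summands are
  -- cleared, the first row is zero off the diagonal and the remaining block is a product of the
  -- same kind, with both index ranges shifted.
  det-LR : ∀ n (L R : ℕ → ℕ → Carrier) →
    (∀ i k → i ℕ.< k → L i k ≈ 0#) →
    (∀ k j → j ℕ.< k → R k j ≈ 0#) →
    (∀ k → R k k ≈ 1#) →
    det {n} (λ i j → ∑[ k < n ] (L (toℕ i) (toℕ k) * R (toℕ k) (toℕ j))) ≈ ∏ n (λ k → L k k)
  det-LR zero    L R L-lower R-upper R-unit = refl
  det-LR (suc n) L R L-lower R-upper R-unit = begin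
    det (λ i j → L (toℕ i) 0 * R 0 (toℕ j) + rest i j)   ≈⟨ det-cong clear ⟩
    det (addZeroth (λ j → R 0 (suc (toℕ j))) M)          ≈⟨ det-addZeroth _ M ⟩
    det M                                                ≈⟨ det-zero-row M M-zero-row ⟩
    L 0 0 * det (λ i j → rest (suc i) (suc j))
      ≈⟨ *-congˡ (det-LR n (λ i k → L (suc i) (suc k)) (λ k j → R (suc k) (suc j))
           (λ i k i<k → L-lower (suc i) (suc k) (s≤s i<k))
           (λ k j j<k → R-upper (suc k) (suc j) (s≤s j<k))
           (λ k → R-unit (suc k))) ⟩
    L 0 0 * ∏ n (λ k → L (suc k) (suc k))                ∎
    where
    rest : Matrix (suc n)
    rest i j = ∑[ k < n ] (L (toℕ i) (suc (toℕ k)) * R (suc (toℕ k)) (toℕ j))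
    -- The product after the clearing of the k = 0 summands; `addZeroth` restores them.
    M : Matrix (suc n)
    M i zero    = L (toℕ i) 0
    M i (suc j) = rest i (suc j)

    clear : ∀ i j → L (toℕ i) 0 * R 0 (toℕ j) + rest i j ≈ addZeroth (λ j → R 0 (suc (toℕ j))) M i j
    clear i zero    = begin
      L (toℕ i) 0 * R 0 0 + rest i zero
        ≈⟨ +-cong (*-congˡ (R-unit 0)) (sum-zero {n} λ k →
             trans (*-congˡ (R-upper (suc (toℕ k)) 0 (s≤s z≤n))) (zeroʳ _)) ⟩
      L (toℕ i) 0 * 1# + 0#   ≈⟨ +-identityʳ _ ⟩
      L (toℕ i) 0 * 1#        ≈⟨ *-identityʳ _ ⟩
      L (toℕ i) 0             ∎
    clear i (suc j) = trans (+-comm _ _) (+-congˡ (*-comm _ _))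

    M-zero-row : ∀ j → M zero (suc j) ≈ 0#
    M-zero-row j = sum-zero {n} λ k →
      trans (*-congʳ (L-lower 0 (suc (toℕ k)) (s≤s z≤n))) (zeroˡ _)

-- Finite sums over initial segments.

module SumProperties {c ℓ} (A : CommutativeRing c ℓ) where
  open CommutativeRing A hiding (zero)
  open Sum semiring
  open SetoidReasoning setoid

  ∑-last : ∀ n (f : ℕ → Carrier) → ∑[ i < suc n ] f (toℕ i) ≈ ∑[ i < n ] f (toℕ i) + f n
  ∑-last zero    f = +-comm _ _
  ∑-last (suc n) f = trans (+-congˡ (∑-last n (f ∘ suc))) (sym (+-assoc _ _ _))

  ∑-empty : ∀ {n} (f : ℕ → Carrier) → n ≡ 0 → ∑[ i < n ] f (toℕ i) ≈ 0#
  ∑-empty f ≡.refl = refl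

  ∑-drop : ∀ k n (f : ℕ → Carrier) → (∀ i → i ℕ.< k → f i ≈ 0#) →
    ∑[ i < n ] f (toℕ i) ≈ ∑[ i < n ∸ k ] f (k ℕ.+ toℕ i)
  ∑-drop zero    n       f f≈0 = refl
  ∑-drop (suc k) zero    f f≈0 = refl
  ∑-drop (suc k) (suc n) f f≈0 = trans
    (+-cong (f≈0 0 (s≤s z≤n)) (∑-drop k n (f ∘ suc) (λ i i<k → f≈0 (suc i) (s≤s i<k))))
    (+-identityˡ _)

  -- The pattern of a triangular recurrence: an entry of the next row takes `f` from the same index
  -- and `g` from the preceding one, and the row ends where `f` vanishes.
  ∑-shifted-+ : ∀ n (f g h : ℕ → Carrier) →
    h 0 ≈ f 0 → (∀ i → h (suc i) ≈ f (suc i) + g i) → f (suc n) ≈ 0# →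
    ∑[ i < 2 ℕ.+ n ] h (toℕ i) ≈ ∑[ i < suc n ] f (toℕ i) + ∑[ i < suc n ] g (toℕ i)
  ∑-shifted-+ n f g h h₀ hₛ f≈0 = begin
    h 0 + ∑[ i < suc n ] h (suc (toℕ i))
      ≈⟨ +-cong h₀ (sum-cong-≋ {suc n} λ i → hₛ (toℕ i)) ⟩
    f 0 + ∑[ i < suc n ] (f (suc (toℕ i)) + g (toℕ i))
      ≈⟨ +-congˡ (∑-distrib-+ {suc n} (λ i → f (suc (toℕ i))) (λ i → g (toℕ i))) ⟩
    f 0 + (∑[ i < suc n ] f (suc (toℕ i)) + ∑[ i < suc n ] g (toℕ i))
      ≈⟨ +-assoc _ _ _ ⟨
    ∑[ i < 2 ℕ.+ n ] f (toℕ i) + ∑[ i < suc n ] g (toℕ i)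
      ≈⟨ +-congʳ (∑-last (suc n) f) ⟩
    ∑[ i < suc n ] f (toℕ i) + f (suc n) + ∑[ i < suc n ] g (toℕ i)
      ≈⟨ +-congʳ (trans (+-congˡ f≈0) (+-identityʳ _)) ⟩
    ∑[ i < suc n ] f (toℕ i) + ∑[ i < suc n ] g (toℕ i) ∎

  ∑-linear₂ : ∀ n (a b : Carrier) (x y : Fin n → Carrier) →
    ∑[ i < n ] (a * x i + b * y i) ≈ a * sum x + b * sum y
  ∑-linear₂ n a b x y = trans (∑-distrib-+ (λ i → a * x i) (λ i → b * y i))
    (+-cong (sym (*-distribˡ-sum a x)) (sym (*-distribˡ-sum b y)))

  ∑-linear₃ : ∀ n (a b c : Carrier) (x y z : Fin n → Carrier) →
    ∑[ i < n ] (a * x i + b * y i + c * z i) ≈ a * sum x + b * sum y + c * sum z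
  ∑-linear₃ n a b c x y z = trans (∑-distrib-+ (λ i → a * x i + b * y i) (λ i → c * z i))
    (+-cong (∑-linear₂ n a b x y) (sym (*-distribˡ-sum c z)))

-- Weighted Motzkin paths: their continued fraction and Hankel determinants.

module Tableau {c ℓ} (A : CommutativeRing c ℓ)
  (b lam : ℕ → CommutativeRing.Carrier A) where

  open CommutativeRing A hiding (zero)
  open Sum semiring
  open SumProperties A
  open SeriesProperties A
  open DeterminantProperties A
  open PowerSeries A using (Series; 𝟙; convergent; _⟶_; 1/-inverseʳ)
    renaming (_*_ to _⊛_)
  open Determinant A using (det; hankelTransform)
  open SetoidReasoning setoid

  -- Paths are split by their last step: up steps weigh 1, level steps weigh `b` of their height,
  -- and down steps weigh `lam` of the height they leave.
  T : ℕ → ℕ → Carrier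
  T zero    zero    = 1#
  T zero    (suc k) = 0#
  T (suc n) zero    = b 0 * T n 0 + lam 1 * T n 1
  T (suc n) (suc k) = T n k + b (suc k) * T n (suc k) + lam (suc (suc k)) * T n (suc (suc k))

  T-upper : ∀ n k → n ℕ.< k → T n k ≈ 0#
  T-upper zero    (suc k) _         = refl
  T-upper (suc n) (suc k) (s≤s n<k) = begin
    T n k + b (suc k) * T n (suc k) + lam (2 ℕ.+ k) * T n (2 ℕ.+ k)
      ≈⟨ +-cong (+-cong (T-upper n k n<k) (*-congˡ (T-upper n (suc k) n<1+k)))
                (*-congˡ (T-upper n (2 ℕ.+ k) (ℕ.m≤n⇒m≤1+n n<1+k))) ⟩
    0# + b (suc k) * 0# + lam (2 ℕ.+ k) * 0#
      ≈⟨ +-cong (+-congˡ (zeroʳ _)) (zeroʳ _) ⟩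
    0# + 0# + 0#   ≈⟨ +-identityʳ _ ⟩
    0# + 0#        ≈⟨ +-identityʳ _ ⟩
    0#             ∎
    where
    n<1+k : n ℕ.< suc k
    n<1+k = ℕ.m≤n⇒m≤1+n n<k

  T-diagonal : ∀ n → T n n ≈ 1#
  T-diagonal zero    = refl
  T-diagonal (suc n) = begin
    T n n + b (suc n) * T n (suc n) + lam (2 ℕ.+ n) * T n (2 ℕ.+ n)
      ≈⟨ +-cong (+-cong (T-diagonal n) (*-congˡ (T-upper n (suc n) ℕ.≤-refl)))
                (*-congˡ (T-upper n (2 ℕ.+ n) (ℕ.m≤n⇒m≤1+n ℕ.≤-refl))) ⟩
    1# + b (suc n) * 0# + lam (2 ℕ.+ n) * 0#
      ≈⟨ +-cong (+-congˡ (zeroʳ _)) (zeroʳ _) ⟩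
    1# + 0# + 0#   ≈⟨ +-identityʳ _ ⟩
    1# + 0#        ≈⟨ +-identityʳ _ ⟩
    1#             ∎

  moment : ℕ → Carrier
  moment n = T n 0

  convergent-⟶-moment : convergent b lam ⟶ moment
  -- `agree N` covers all degrees up to N, so the required precision d itself serves as the witness.
  convergent-⟶-moment d = d , λ N d≤N i i<d → agree N i (ℕ.m≤n⇒m≤1+n (ℕ.<-≤-trans i<d d≤N))
    where
    agree : ∀ N → convergent b lam N ≈[ suc N ] moment
    agree zero    zero (s≤s z≤n) = refl
    agree (suc N) =
      ⊛-cancelˡ D (denominator-0 (b 0) (lam 1) K) (suc (suc N)) λ i i<2+N →
        trans (1/-inverseʳ D (denominator-0 (b 0) (lam 1) K) i) (sym (D⊛moment i i<2+N))
      where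
      K D : Series
      K = convergent (b ∘ suc) (lam ∘ suc) N
      D = denominator (b 0) (lam 1) K
      D⊛moment : ∀ i → i ℕ.< suc (suc N) → (D ⊛ moment) i ≈ 𝟙 i
      D⊛moment zero    _ = trans (denominator-⊛ (b 0) (lam 1) K moment 0)
        (cancel-terms 1# (b 0 * 0#) (lam 1 * 0#) 0-terms refl)
        where
        0-terms : 1# ≈ 1# + b 0 * 0# + lam 1 * 0#
        0-terms = begin
          1#                           ≈⟨ +-identityʳ _ ⟨
          1# + 0#                      ≈⟨ +-identityʳ _ ⟨
          1# + 0# + 0#                 ≈⟨ +-cong (+-congˡ (zeroʳ _)) (zeroʳ _) ⟨
          1# + b 0 * 0# + lam 1 * 0#   ∎
      D⊛moment (suc n) (s≤s n<1+N) = trans (denominator-⊛ (b 0) (lam 1) K moment (suc n))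
        (cancel-terms 0# (b 0 * T n 0) (lam 1 * T n 1)
          (+-congʳ (sym (+-identityˡ _)))
          -- The columns of `T` obey the recurrence of `convergent-F` with coefficients shifted by
          -- one, so column 1 is z K times the moment series up to this degree.
          (*-congˡ (convergent-F N (b ∘ suc) (lam ∘ suc) (λ k i → T i k)
            (λ _ → refl) (λ _ _ → refl) n n<1+N)))

  Λ : ℕ → Carrier
  Λ zero    = 1#
  Λ (suc k) = Λ k * lam (suc k)

  -- An entry of the LDLᵀ product, cut at `N`; row `i` of `T` ends at column `i`, so the cut is
  -- harmless once `i` is below `N`.
  bilinear : ℕ → ℕ → ℕ → Carrier
  bilinear N i j = ∑[ k < N ] (T i (toℕ k) * (Λ (toℕ k) * T j (toℕ k)))

  -- The operator T n ↦ T (suc n) is symmetric for the weights Λ, up to the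
  -- boundary terms of the summation by parts.
  bilinear-parts : ∀ N i j →
    bilinear (suc N) (suc i) j + Λ (suc N) * (T i N * T j (suc N)) ≈
    bilinear (suc N) i (suc j) + Λ (suc N) * (T i (suc N) * T j N)
  bilinear-parts zero i j = solve 6 (λ l b0 x x′ y y′ →
      (b0 :* x :+ l :* x′) :* (con 1 :* y) :+ con 0 :+ con 1 :* l :* (x :* y′) :=
      x :* (con 1 :* (b0 :* y :+ l :* y′)) :+ con 0 :+ con 1 :* l :* (x′ :* y))
    refl (lam 1) (b 0) (T i 0) (T i 1) (T j 0) (T j 1)
    where open Solver commutativeSemiring
  bilinear-parts (suc N) i j = begin
    bilinear (2 ℕ.+ N) (suc i) j + Λ (2 ℕ.+ N) * (T i (suc N) * T j (2 ℕ.+ N))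
      ≈⟨ +-congʳ (∑-last (suc N) (λ k → T (suc i) k * (Λ k * T j k))) ⟩
    bilinear (suc N) (suc i) j + T (suc i) (suc N) * (Λ (suc N) * T j (suc N))
      + Λ (2 ℕ.+ N) * (T i (suc N) * T j (2 ℕ.+ N))
      -- Isolates the left side of the induction hypothesis; the rest is symmetric under exchange of
      -- the x and y, so it serves both sides.
      ≈⟨ solve 9 (λ P β μ l x₀ x₁ x₂ y₁ y₂ →
             P :+ (x₀ :+ β :* x₁ :+ μ :* x₂) :* (l :* y₁) :+ l :* μ :* (x₁ :* y₂) :=
             (P :+ l :* (x₀ :* y₁)) :+ l :* (β :* x₁ :* y₁ :+ μ :* x₂ :* y₁ :+ μ :* x₁ :* y₂))
           refl (bilinear (suc N) (suc i) j) β μ l x₀ x₁ x₂ y₁ y₂ ⟩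
    (bilinear (suc N) (suc i) j + l * (x₀ * y₁)) + l * (β * x₁ * y₁ + μ * x₂ * y₁ + μ * x₁ * y₂)
      ≈⟨ +-congʳ (bilinear-parts N i j) ⟩
    (bilinear (suc N) i (suc j) + l * (x₁ * y₀)) + l * (β * x₁ * y₁ + μ * x₂ * y₁ + μ * x₁ * y₂)
      ≈⟨ solve 9 (λ Q β μ l x₁ x₂ y₀ y₁ y₂ →
             (Q :+ l :* (x₁ :* y₀)) :+ l :* (β :* x₁ :* y₁ :+ μ :* x₂ :* y₁ :+ μ :* x₁ :* y₂) :=
             Q :+ x₁ :* (l :* (y₀ :+ β :* y₁ :+ μ :* y₂)) :+ l :* μ :* (x₂ :* y₁))
           refl (bilinear (suc N) i (suc j)) β μ l x₁ x₂ y₀ y₁ y₂ ⟩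
    bilinear (suc N) i (suc j) + T i (suc N) * (Λ (suc N) * T (suc j) (suc N))
      + Λ (2 ℕ.+ N) * (T i (2 ℕ.+ N) * T j (suc N))
      ≈⟨ +-congʳ (∑-last (suc N) (λ k → T i k * (Λ k * T (suc j) k))) ⟨
    bilinear (2 ℕ.+ N) i (suc j) + Λ (2 ℕ.+ N) * (T i (2 ℕ.+ N) * T j (suc N)) ∎
    where
    open Solver commutativeSemiring
    β = b (suc N)
    μ = lam (2 ℕ.+ N)
    l = Λ (suc N)
    x₀ = T i N
    x₁ = T i (suc N)
    x₂ = T i (2 ℕ.+ N)
    y₀ = T j N
    y₁ = T j (suc N)
    y₂ = T j (2 ℕ.+ N)

  bilinear-suc : ∀ {N i} j → i ℕ.< N → bilinear (suc N) i j ≈ bilinear N i j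
  bilinear-suc {N} {i} j i<N = begin
    bilinear (suc N) i j                     ≈⟨ ∑-last N (λ k → T i k * (Λ k * T j k)) ⟩
    bilinear N i j + T i N * (Λ N * T j N)   ≈⟨ +-congˡ (trans (*-congʳ (T-upper i N i<N)) (zeroˡ _)) ⟩
    bilinear N i j + 0#                      ≈⟨ +-identityʳ _ ⟩
    bilinear N i j                           ∎

  -- The cut is first lowered to i + 1. Then `bilinear-parts` moves one step from the first path to
  -- the second, until the first is empty; the boundary terms vanish because row `i` has no entry
  -- beyond column `i`.
  bilinear-moment : ∀ {N} i j → i ℕ.<′ N → bilinear N i j ≈ moment (i ℕ.+ j)
  bilinear-moment i       j (ℕ.≤′-step i<N) =
    trans (bilinear-suc j (ℕ.≤′⇒≤ i<N)) (bilinear-moment i j i<N)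
  bilinear-moment zero    j ℕ.≤′-refl = begin
    1# * (1# * T j 0) + 0#   ≈⟨ +-identityʳ _ ⟩
    1# * (1# * T j 0)        ≈⟨ *-identityˡ _ ⟩
    1# * T j 0               ≈⟨ *-identityˡ _ ⟩
    T j 0                    ∎
  bilinear-moment (suc i) j ℕ.≤′-refl = begin
    bilinear (2 ℕ.+ i) (suc i) j         ≈⟨ +-identityʳ _ ⟨
    bilinear (2 ℕ.+ i) (suc i) j + 0#
      ≈⟨ +-congˡ (boundary (ℕ.n<1+n i)) ⟨
    bilinear (2 ℕ.+ i) (suc i) j + Λ (2 ℕ.+ i) * (T i (suc i) * T j (2 ℕ.+ i))
      ≈⟨ bilinear-parts (suc i) i j ⟩
    bilinear (2 ℕ.+ i) i (suc j) + Λ (2 ℕ.+ i) * (T i (2 ℕ.+ i) * T j (suc i))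
      ≈⟨ +-congˡ (boundary (ℕ.m<n⇒m<1+n (ℕ.n<1+n i))) ⟩
    bilinear (2 ℕ.+ i) i (suc j) + 0#    ≈⟨ +-identityʳ _ ⟩
    bilinear (2 ℕ.+ i) i (suc j)         ≈⟨ bilinear-moment i (suc j) (ℕ.≤′-step ℕ.≤′-refl) ⟩
    moment (i ℕ.+ suc j)                 ≡⟨ ≡.cong moment (ℕ.+-suc i j) ⟩
    moment (suc i ℕ.+ j)                 ∎
    where
    boundary : ∀ {k x y} → i ℕ.< k → x * (T i k * y) ≈ 0#
    boundary i<k = trans (*-congˡ (trans (*-congʳ (T-upper i _ i<k)) (zeroˡ _))) (zeroʳ _)

  -- In the factorisation the weights `Λ` are absorbed into the lower triangular factor, and the
  -- transpose of `T` is the unitriangular one.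
  hankel-moment : ∀ n → hankelTransform moment n ≈ ∏ (suc n) Λ
  hankel-moment n = begin
    hankelTransform moment n
      ≈⟨ det-cong {suc n} (λ i j → trans
           (sym (bilinear-moment (toℕ i) (toℕ j) (ℕ.≤⇒≤′ (Fin.toℕ<n i))))
           (sum-cong-≋ {suc n} λ k → sym (*-assoc (T (toℕ i) (toℕ k)) (Λ (toℕ k)) (T (toℕ j) (toℕ k))))) ⟩
    det {suc n} (λ i j → ∑[ k < suc n ] (T (toℕ i) (toℕ k) * Λ (toℕ k) * T (toℕ j) (toℕ k)))
      ≈⟨ det-LR (suc n) (λ i k → T i k * Λ k) (λ k j → T j k)
           (λ i k i<k → trans (*-congʳ (T-upper i k i<k)) (zeroˡ _))
           (λ k j → T-upper j k) T-diagonal ⟩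
    ∏ (suc n) (λ k → T k k * Λ k)
      ≈⟨ ∏-cong (suc n) {g = Λ} (λ k → trans (*-congʳ (T-diagonal k)) (*-identityˡ _)) ⟩
    ∏ (suc n) Λ ∎

-- Binomial and Stirling identities over the natural numbers.

-- The absorption identity (k + 1) C(j, k + 1) = (j - k) C(j, k), freed of subtraction.
C-absorb : ∀ j k → suc k ℕ.* (j C suc k) ℕ.+ k ℕ.* (j C k) ≡ j ℕ.* (j C k)
C-absorb zero    zero    = ≡.refl
C-absorb zero    (suc k) = ≡.cong₂ ℕ._+_ (ℕ.*-zeroʳ (suc (suc k))) (ℕ.*-zeroʳ (suc k))
C-absorb (suc j) zero    = begin
  1 ℕ.* (suc j C 1) ℕ.+ 0   ≡⟨ ℕ.+-identityʳ _ ⟩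
  1 ℕ.* (suc j C 1)         ≡⟨ ℕ.*-identityˡ _ ⟩
  suc j C 1                 ≡⟨ nC1≡n (suc j) ⟩
  suc j                     ≡⟨ ℕ.*-identityʳ (suc j) ⟨
  suc j ℕ.* 1               ∎
  where open ≡.≡-Reasoning
C-absorb (suc j) (suc k) = begin
  suc (suc k) ℕ.* (suc j C suc (suc k)) ℕ.+ suc k ℕ.* (suc j C suc k)
    ≡⟨ ≡.cong₂ (λ x y → suc (suc k) ℕ.* x ℕ.+ suc k ℕ.* y)
               (nCk+nC[k+1]≡[n+1]C[k+1] j (suc k)) (nCk+nC[k+1]≡[n+1]C[k+1] j k) ⟨
  suc (suc k) ℕ.* (c₁ ℕ.+ c₂) ℕ.+ suc k ℕ.* (c₀ ℕ.+ c₁)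
    ≡⟨ solve 4 (λ k c₀ c₁ c₂ →
         (con 2 :+ k) :* (c₁ :+ c₂) :+ (con 1 :+ k) :* (c₀ :+ c₁) :=
         ((con 2 :+ k) :* c₂ :+ (con 1 :+ k) :* c₁) :+ ((con 1 :+ k) :* c₁ :+ k :* c₀) :+ (c₀ :+ c₁))
       ≡.refl k c₀ c₁ c₂ ⟩
  (suc (suc k) ℕ.* c₂ ℕ.+ suc k ℕ.* c₁) ℕ.+ (suc k ℕ.* c₁ ℕ.+ k ℕ.* c₀) ℕ.+ (c₀ ℕ.+ c₁)
    ≡⟨ ≡.cong₂ (λ x y → x ℕ.+ y ℕ.+ (c₀ ℕ.+ c₁)) (C-absorb j (suc k)) (C-absorb j k) ⟩
  j ℕ.* c₁ ℕ.+ j ℕ.* c₀ ℕ.+ (c₀ ℕ.+ c₁)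
    ≡⟨ solve 3 (λ j c₀ c₁ → j :* c₁ :+ j :* c₀ :+ (c₀ :+ c₁) := (con 1 :+ j) :* (c₀ :+ c₁)) ≡.refl j c₀ c₁ ⟩
  suc j ℕ.* (c₀ ℕ.+ c₁)
    ≡⟨ ≡.cong (suc j ℕ.*_) (nCk+nC[k+1]≡[n+1]C[k+1] j k) ⟩
  suc j ℕ.* (suc j C suc k) ∎
  where
  open ≡.≡-Reasoning
  open ℕSolver.+-*-Solver
  c₀ = j C k
  c₁ = j C suc k
  c₂ = j C suc (suc k)

-- Absorption at j + 1 followed by Pascal's rule. It trades the factor j + 1 for coefficients
-- depending on `k` alone, as a column recurrence requires.
C-absorb-suc : ∀ j k →
  suc j ℕ.* (suc j C suc k) ≡
  suc k ℕ.* (j C k) ℕ.+ (1 ℕ.+ 2 ℕ.* suc k) ℕ.* (j C suc k) ℕ.+ (2 ℕ.+ k) ℕ.* (j C (2 ℕ.+ k))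
C-absorb-suc j k = begin
  suc j ℕ.* (suc j C suc k)
    ≡⟨ C-absorb (suc j) (suc k) ⟨
  suc (suc k) ℕ.* (suc j C suc (suc k)) ℕ.+ suc k ℕ.* (suc j C suc k)
    ≡⟨ ≡.cong₂ (λ x y → suc (suc k) ℕ.* x ℕ.+ suc k ℕ.* y)
               (nCk+nC[k+1]≡[n+1]C[k+1] j (suc k)) (nCk+nC[k+1]≡[n+1]C[k+1] j k) ⟨
  suc (suc k) ℕ.* (j C suc k ℕ.+ j C suc (suc k)) ℕ.+ suc k ℕ.* (j C k ℕ.+ j C suc k)
    ≡⟨ solve 4 (λ k c₀ c₁ c₂ →
         (con 2 :+ k) :* (c₁ :+ c₂) :+ (con 1 :+ k) :* (c₀ :+ c₁) :=
         (con 1 :+ k) :* c₀ :+ (con 1 :+ con 2 :* (con 1 :+ k)) :* c₁ :+ (con 2 :+ k) :* c₂)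
       ≡.refl k (j C k) (j C suc k) (j C (2 ℕ.+ k)) ⟩
  suc k ℕ.* (j C k) ℕ.+ (1 ℕ.+ 2 ℕ.* suc k) ℕ.* (j C suc k) ℕ.+ (2 ℕ.+ k) ℕ.* (j C (2 ℕ.+ k)) ∎
  where
  open ≡.≡-Reasoning
  open ℕSolver.+-*-Solver

stirling₂-upper : ∀ {n k} → n ℕ.< k → stirling₂ n k ≡ 0
stirling₂-upper {zero}  {suc k} _         = ≡.refl
stirling₂-upper {suc n} {suc k} (s≤s n<k) = ≡.cong₂ ℕ._+_
  (≡.trans (≡.cong (suc k ℕ.*_) (stirling₂-upper (ℕ.m<n⇒m<1+n n<k))) (ℕ.*-zeroʳ (suc k)))
  (stirling₂-upper n<k)

-- Natural multiples in a ring.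

module MultipleProperties {c ℓ} (A : CommutativeRing c ℓ) where

  open CommutativeRing A hiding (zero)
  open Mult semiring

  -- Writing multiples as products with `ι n` brings them within reach of the ring solver.
  ι : ℕ → Carrier
  ι n = n × 1#

  ×≈ι* : ∀ n x → n × x ≈ ι n * x
  ×≈ι* n x = trans (×-congʳ n (sym (*-identityˡ x))) (sym (×-assoc-* n 1# x))

  ×-zeroʳ : ∀ n → n × 0# ≈ 0#
  ×-zeroʳ n = trans (×≈ι* n 0#) (zeroʳ (ι n))

  ι-homo-+ : ∀ m n → ι (m ℕ.+ n) ≈ ι m + ι n
  ι-homo-+ = ×-homo-+ 1#

  ι-homo-* : ∀ m n → ι (m ℕ.* n) ≈ ι m * ι n
  ι-homo-* = ×1-homo-*

-- The triangular recurrence of the Whitney numbers.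

module WhitneyProperties {c ℓ} (R : CommutativeRing c ℓ) (m : CommutativeRing.Carrier R) where

  open CommutativeRing R hiding (zero)
  open Exp semiring using (_^_)
  open Mult semiring
  open Sum semiring renaming (sum to ∑)
  open SumProperties R
  open MultipleProperties R
  open EulerianDowling R m using (W)
  open SetoidReasoning setoid

  -- With S i k = 0 for i < k, the truncated exponent is harmless.
  scaledStirling : ℕ → ℕ → Carrier
  scaledStirling i k = stirling₂ i k × (m ^ (i ∸ k))

  scaledStirling-suc : ∀ i k →
    scaledStirling (suc i) (suc k) ≈ (suc k × m) * scaledStirling i (suc k) + scaledStirling i k
  scaledStirling-suc i k = begin
    (suc k ℕ.* S₁ ℕ.+ stirling₂ i k) × (m ^ (i ∸ k))
      ≈⟨ ×-homo-+ _ (suc k ℕ.* S₁) _ ⟩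
    (suc k ℕ.* S₁) × (m ^ (i ∸ k)) + scaledStirling i k
      ≈⟨ +-congʳ (×-assocˡ _ (suc k) S₁) ⟨
    suc k × (S₁ × (m ^ (i ∸ k))) + scaledStirling i k
      ≈⟨ +-congʳ (×-congʳ (suc k) extract-m) ⟩
    suc k × (m * scaledStirling i (suc k)) + scaledStirling i k
      ≈⟨ +-congʳ (×-assoc-* (suc k) m _) ⟨
    (suc k × m) * scaledStirling i (suc k) + scaledStirling i k ∎
    where
    S₁ = stirling₂ i (suc k)
    -- A factor m splits off only if k < i; otherwise the truncated exponents are both 0, but S(i, k
    -- + 1) = 0 kills both sides.
    extract-m : S₁ × (m ^ (i ∸ k)) ≈ m * scaledStirling i (suc k)
    extract-m with k ℕ.<? i
    ... | yes (s≤s k≤i) = begin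
      S₁ × (m ^ (i ∸ k))             ≡⟨ ≡.cong (λ e → S₁ × (m ^ e)) (ℕ.+-∸-assoc 1 k≤i) ⟩
      S₁ × (m * m ^ (i ∸ suc k))     ≈⟨ ×-comm-* S₁ m _ ⟨
      m * scaledStirling i (suc k)   ∎
    ... | no  k≮i = begin
      S₁ × (m ^ (i ∸ k))             ≈⟨ ×-congˡ S₁≡0 ⟩
      0#                             ≈⟨ zeroʳ m ⟨
      m * 0#                         ≈⟨ *-congˡ (×-congˡ S₁≡0) ⟨
      m * scaledStirling i (suc k)   ∎
      where
      S₁≡0 : S₁ ≡ 0
      S₁≡0 = stirling₂-upper (s≤s (ℕ.≮⇒≥ k≮i))

  -- Extending the sum down to i = 0 adds only zero Stirling numbers and makes the range independent
  -- of `k`, so sums for different `k` can be combined termwise.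
  W-binomial : ∀ n k → W n k ≈ ∑[ i < suc n ] ((n C toℕ i) × scaledStirling (toℕ i) k)
  W-binomial n k = sym (begin
    ∑[ i < suc n ] ((n C toℕ i) × scaledStirling (toℕ i) k)
      ≈⟨ ∑-drop k (suc n) (λ i → (n C i) × scaledStirling i k)
           (λ i i<k → trans (×-congʳ (n C i) (×-congˡ (stirling₂-upper i<k))) (×-zeroʳ (n C i))) ⟩
    ∑[ j < suc n ∸ k ] ((n C (k ℕ.+ toℕ j)) × scaledStirling (k ℕ.+ toℕ j) k)
      ≈⟨ sum-cong-≋ {suc n ∸ k} (λ j → trans
           (×-assocˡ _ (n C (k ℕ.+ toℕ j)) _)
           (×-congʳ ((n C (k ℕ.+ toℕ j)) ℕ.* stirling₂ (k ℕ.+ toℕ j) k)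
             (reflexive (≡.cong (m ^_) (ℕ.m+n∸m≡n k (toℕ j)))))) ⟩
    W n k ∎)

  W-upper : ∀ n k → n ℕ.< k → W n k ≈ 0#
  W-upper n k n<k = ∑-empty
    (λ j → ((n C (k ℕ.+ j)) ℕ.* stirling₂ (k ℕ.+ j) k) × (m ^ j)) (ℕ.m≤n⇒m∸n≡0 n<k)

  W-0-0 : W 0 0 ≈ 1#
  W-0-0 = trans (+-identityʳ _) (+-identityʳ _)

  -- Pascal's rule applied to the binomial factor; C(n, n + 1) = 0 closes the range.
  W-pascal : ∀ n k → W (suc n) k ≈ W n k + ∑[ i < suc n ] ((n C toℕ i) × scaledStirling (suc (toℕ i)) k)
  W-pascal n k = begin
    W (suc n) k
      ≈⟨ W-binomial (suc n) k ⟩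
    ∑[ i < 2 ℕ.+ n ] ((suc n C toℕ i) × scaledStirling (toℕ i) k)
      ≈⟨ ∑-shifted-+ n (λ i → (n C i) × scaledStirling i k) (λ i → (n C i) × scaledStirling (suc i) k)
           (λ i → (suc n C i) × scaledStirling i k)
           refl pascal (×-congˡ (k>n⇒nCk≡0 (ℕ.n<1+n n))) ⟩
    ∑[ i < suc n ] ((n C toℕ i) × scaledStirling (toℕ i) k)
      + ∑[ i < suc n ] ((n C toℕ i) × scaledStirling (suc (toℕ i)) k)
      ≈⟨ +-congʳ (W-binomial n k) ⟨
    W n k + ∑[ i < suc n ] ((n C toℕ i) × scaledStirling (suc (toℕ i)) k) ∎
    where
    pascal : ∀ i → (suc n C suc i) × scaledStirling (suc i) k ≈
      (n C suc i) × scaledStirling (suc i) k + (n C i) × scaledStirling (suc i) k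
    pascal i = begin
      (suc n C suc i) × x            ≡⟨ ≡.cong (_× x) (nCk+nC[k+1]≡[n+1]C[k+1] n i) ⟨
      (n C i ℕ.+ n C suc i) × x      ≈⟨ ×-homo-+ x (n C i) _ ⟩
      (n C i) × x + (n C suc i) × x  ≈⟨ +-comm _ _ ⟩
      (n C suc i) × x + (n C i) × x  ∎
      where x = scaledStirling (suc i) k

  W-suc-0 : ∀ n → W (suc n) 0 ≈ W n 0
  W-suc-0 n = begin
    W (suc n) 0
      ≈⟨ W-pascal n 0 ⟩
    W n 0 + ∑[ i < suc n ] ((n C toℕ i) × 0#)
      ≈⟨ +-congˡ (sum-cong-≋ {suc n} (λ i → ×-zeroʳ (n C toℕ i))) ⟩
    W n 0 + ∑[ i < suc n ] 0#
      ≈⟨ +-congˡ (sum-replicate-zero (suc n)) ⟩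
    W n 0 + 0#   ≈⟨ +-identityʳ _ ⟩
    W n 0        ∎

  -- In the coefficient 1 + (k + 1) m of W(n, k + 1), the 1 comes from Pascal's rule and (k + 1) m
  -- from the Stirling recurrence.
  W-suc-suc : ∀ n k → W (suc n) (suc k) ≈ W n (suc k) + ((suc k × m) * W n (suc k) + W n k)
  W-suc-suc n k = trans (W-pascal n (suc k)) (+-congˡ (begin
    ∑[ i < suc n ] ((n C toℕ i) × scaledStirling (suc (toℕ i)) (suc k))
      ≈⟨ sum-cong-≋ {suc n} term ⟩
    ∑[ i < suc n ] ((suc k × m) * x i + 1# * y i)
      ≈⟨ ∑-linear₂ (suc n) (suc k × m) 1# x y ⟩
    (suc k × m) * ∑ x + 1# * ∑ y
      ≈⟨ +-cong (*-congˡ (W-binomial n (suc k))) (trans (W-binomial n k) (sym (*-identityˡ _))) ⟨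
    (suc k × m) * W n (suc k) + W n k ∎))
    where
    x y : Fin (suc n) → Carrier
    x i = (n C toℕ i) × scaledStirling (toℕ i) (suc k)
    y i = (n C toℕ i) × scaledStirling (toℕ i) k
    term : ∀ i → (n C toℕ i) × scaledStirling (suc (toℕ i)) (suc k) ≈ (suc k × m) * x i + 1# * y i
    term i = begin
      b × scaledStirling (suc (toℕ i)) (suc k)
        ≈⟨ ×-congʳ b (scaledStirling-suc (toℕ i) k) ⟩
      b × ((suc k × m) * scaledStirling (toℕ i) (suc k) + scaledStirling (toℕ i) k)
        ≈⟨ ×≈ι* b _ ⟩
      ι b * ((suc k × m) * scaledStirling (toℕ i) (suc k) + scaledStirling (toℕ i) k)
        ≈⟨ solve 4 (λ c a s t → c :* (a :* s :+ t) := a :* (c :* s) :+ con 1 :* (c :* t))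
             refl (ι b) (suc k × m) _ _ ⟩
      (suc k × m) * (ι b * scaledStirling (toℕ i) (suc k)) + 1# * (ι b * scaledStirling (toℕ i) k)
        ≈⟨ +-cong (*-congˡ (×≈ι* b _)) (*-congˡ (×≈ι* b _)) ⟨
      (suc k × m) * x i + 1# * y i ∎
      where
      open Solver commutativeSemiring
      b = n C toℕ i

-- The Eulerian-Dowling polynomials as moments of the tableau.

private module ℕExp = CommutativeSemiringExp ℕ.+-*-commutativeSemiring

sum-upTo : ∀ n → ListAction.sum (upTo n) ≡ n C 2
sum-upTo zero    = ≡.refl
sum-upTo (suc n) = begin
  ListAction.sum (upTo (suc n))       ≡⟨ ≡.cong ListAction.sum (applyUpTo-∷ʳ id n) ⟨
  ListAction.sum (upTo n ∷ʳ n)        ≡⟨ sum-++ (upTo n) (n ∷ []) ⟩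
  ListAction.sum (upTo n) ℕ.+ (n ℕ.+ 0)
    ≡⟨ ≡.cong₂ ℕ._+_ (sum-upTo n) (ℕ.+-identityʳ n) ⟩
  n C 2 ℕ.+ n              ≡⟨ ℕ.+-comm (n C 2) n ⟩
  n ℕ.+ n C 2              ≡⟨ ≡.cong (ℕ._+ n C 2) (nC1≡n n) ⟨
  n C 1 ℕ.+ n C 2          ≡⟨ nCk+nC[k+1]≡[n+1]C[k+1] n 1 ⟩
  suc n C 2                ∎
  where open ≡.≡-Reasoning

-- The parameters w n k, M and y play the roles of W_m(n, k), m and x - 1.
module EulerianTableau {c ℓ} (A : CommutativeRing c ℓ) where

  open CommutativeRing A hiding (zero)
  open Mult semiring

  module Rows (M y : Carrier) (w : ℕ → ℕ → Carrier)
    (w-0-0 : w 0 0 ≈ 1#)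
    (w-upper : ∀ n k → n ℕ.< k → w n k ≈ 0#)
    (w-suc-0 : ∀ n → w (suc n) 0 ≈ w n 0)
    (w-suc-suc : ∀ n k → w (suc n) (suc k) ≈ w n (suc k) + ((suc k × M) * w n (suc k) + w n k))
    (b lam : ℕ → Carrier)
    (b≈ : ∀ n → b n ≈ y + 1# + n × (M * y + 2 × 1#))
    (lam≈ : ∀ n → lam n ≈ (n ℕ.^ 2) × (M * y + 1#))
    where

    open Exp semiring using (_^_; ^-homo-*)
    open Sum semiring renaming (sum to ∑)
    open SumProperties A
    open MultipleProperties A
    open DeterminantProperties A using (∏; ∏-cong)
    open Tableau A b lam
    open SetoidReasoning setoid
    open Solver commutativeSemiring

    p : Carrier
    p = M * y

    term : ℕ → ℕ → Carrier
    term n j = (j !) × (w n j * y ^ (n ∸ j))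

    term≈ : ∀ n j → term n j ≈ ι (j !) * (w n j * y ^ (n ∸ j))
    term≈ n j = ×≈ι* (j !) _

    term-upper : ∀ n j → n ℕ.< j → term n j ≈ 0#
    term-upper n j n<j = begin
      (j !) × (w n j * y ^ (n ∸ j))   ≈⟨ ×-congʳ (j !) (trans (*-congʳ (w-upper n j n<j)) (zeroˡ _)) ⟩
      (j !) × 0#                      ≈⟨ ×-zeroʳ (j !) ⟩
      0#                              ∎

    term-suc-0 : ∀ n → term (suc n) 0 ≈ y * term n 0
    term-suc-0 n = begin
      w (suc n) 0 * (y * y ^ n) + 0#   ≈⟨ +-congʳ (*-congʳ (w-suc-0 n)) ⟩
      w n 0 * (y * y ^ n) + 0#
        ≈⟨ solve 3 (λ w y e → w :* (y :* e) :+ con 0 := y :* (w :* e :+ con 0)) refl (w n 0) y (y ^ n) ⟩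
      y * term n 0                     ∎

    -- Coefficient form of the derivative of e^{yz} E^{j+1}, using E′ = 1 + p E.
    term-suc-suc : ∀ n j → term (suc n) (suc j) ≈ (y + suc j × p) * term n (suc j) + suc j × term n j
    term-suc-suc n j = begin
      term (suc n) (suc j)
        ≈⟨ ×≈ι* (suc j !) _ ⟩
      ι (suc j !) * (w (suc n) (suc j) * e)
        ≈⟨ *-cong (ι-homo-* (suc j) (j !)) (*-congʳ (trans (w-suc-suc n j) (+-congˡ (+-congʳ (*-congʳ (×≈ι* (suc j) M)))))) ⟩
      s * f * ((w₁ + (s * M * w₁ + w₀)) * e)
        ≈⟨ solve 6 (λ s f M w₁ w₀ e →
               s :* f :* ((w₁ :+ (s :* M :* w₁ :+ w₀)) :* e) :=
               s :* f :* ((con 1 :+ s :* M) :* (w₁ :* e)) :+ s :* (f :* (w₀ :* e)))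
             refl s f M w₁ w₀ e ⟩
      s * f * ((1# + s * M) * (w₁ * e)) + s * (f * (w₀ * e))
        ≈⟨ +-congʳ (*-congˡ (*-congˡ w₁e≈yu)) ⟩
      s * f * ((1# + s * M) * (y * u)) + s * (f * (w₀ * e))
        ≈⟨ solve 6 (λ s f M y u v →
               s :* f :* ((con 1 :+ s :* M) :* (y :* u)) :+ s :* v :=
               (y :+ s :* (M :* y)) :* (s :* f :* u) :+ s :* v)
             refl s f M y u (f * (w₀ * e)) ⟩
      (y + s * p) * (s * f * u) + s * (f * (w₀ * e))
        ≈⟨ +-cong (*-cong (+-congˡ (×≈ι* (suc j) p))
                          (trans (term≈ n (suc j)) (*-congʳ (ι-homo-* (suc j) (j !)))))
                  (trans (×≈ι* (suc j) _) (*-congˡ (term≈ n j))) ⟨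
      (y + suc j × p) * term n (suc j) + suc j × term n j ∎
      where
      s = ι (suc j)
      f = ι (j !)
      e = y ^ (n ∸ j)
      w₀ = w n j
      w₁ = w n (suc j)
      u = w₁ * y ^ (n ∸ suc j)
      -- For j ≥ n the truncated exponent does not drop, but then `w₁` is zero.
      w₁e≈yu : w₁ * e ≈ y * u
      w₁e≈yu with j ℕ.<? n
      ... | yes (s≤s j≤n) = begin
        w₁ * e                          ≡⟨ ≡.cong (λ k → w₁ * y ^ k) (ℕ.+-∸-assoc 1 j≤n) ⟩
        w₁ * (y * y ^ (n ∸ suc j))      ≈⟨ solve 3 (λ w y e → w :* (y :* e) := y :* (w :* e)) refl w₁ y _ ⟩
        y * u                           ∎
      ... | no  j≮n = begin
        w₁ * e   ≈⟨ *-congʳ w₁≈0 ⟩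
        0# * e   ≈⟨ zeroˡ e ⟩
        0#       ≈⟨ zeroʳ y ⟨
        y * 0#   ≈⟨ *-congˡ (trans (*-congʳ w₁≈0) (zeroˡ _)) ⟨
        y * u    ∎
        where
        w₁≈0 : w₁ ≈ 0#
        w₁≈0 = w-upper n (suc j) (s≤s (ℕ.≮⇒≥ j≮n))

    -- Coefficients of e^{yz} times the power series in E whose j-th coefficient is `φ j`.
    rowSum : (ℕ → ℕ) → ℕ → Carrier
    rowSum φ n = ∑[ j < suc n ] (φ (toℕ j) × term n (toℕ j))

    -- Differentiation in z acts on the coefficients in E by sending φ(j) to (y + j p) φ(j) + (j +
    -- 1) φ(j + 1). A recurrence between rows thus reduces to an identity for each j.
    rowSum-suc : ∀ {φ φ₀ φ₁ φ₂} α β γ →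
      (∀ j → (y + j × p) * ι (φ j) + ι (suc j ℕ.* φ (suc j)) ≈
             α * ι (φ₀ j) + β * ι (φ₁ j) + γ * ι (φ₂ j)) →
      ∀ n → rowSum φ (suc n) ≈ α * rowSum φ₀ n + β * rowSum φ₁ n + γ * rowSum φ₂ n
    rowSum-suc {φ} {φ₀} {φ₁} {φ₂} α β γ eq n = begin
      ∑[ j < 2 ℕ.+ n ] (φ (toℕ j) × term (suc n) (toℕ j))
        ≈⟨ ∑-shifted-+ n f g (λ j → φ j × term (suc n) j) first next
             (trans (*-congˡ (term-upper n (suc n) ℕ.≤-refl)) (zeroʳ _)) ⟩
      ∑[ j < suc n ] f (toℕ j) + ∑[ j < suc n ] g (toℕ j)
        ≈⟨ ∑-distrib-+ {suc n} (f ∘ toℕ) (g ∘ toℕ) ⟨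
      ∑[ j < suc n ] (f (toℕ j) + g (toℕ j))
        ≈⟨ sum-cong-≋ {suc n} (λ j → combine (toℕ j)) ⟩
      ∑[ j < suc n ] (α * (φ₀ (toℕ j) × term n (toℕ j)) + β * (φ₁ (toℕ j) × term n (toℕ j))
                       + γ * (φ₂ (toℕ j) × term n (toℕ j)))
        ≈⟨ ∑-linear₃ (suc n) α β γ (λ j → φ₀ (toℕ j) × term n (toℕ j))
             (λ j → φ₁ (toℕ j) × term n (toℕ j)) (λ j → φ₂ (toℕ j) × term n (toℕ j)) ⟩
      α * rowSum φ₀ n + β * rowSum φ₁ n + γ * rowSum φ₂ n ∎
      where
      -- `f j` and `g j` are what `term n j` contributes to the entries j and j + 1 of the next row.
      f g : ℕ → Carrier
      f j = (y + j × p) * ι (φ j) * term n j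
      g j = ι (suc j ℕ.* φ (suc j)) * term n j

      first : φ 0 × term (suc n) 0 ≈ f 0
      first = begin
        φ 0 × term (suc n) 0               ≈⟨ ×≈ι* (φ 0) _ ⟩
        ι (φ 0) * term (suc n) 0           ≈⟨ *-congˡ (term-suc-0 n) ⟩
        ι (φ 0) * (y * term n 0)
          ≈⟨ solve 3 (λ φ y t → φ :* (y :* t) := (y :+ con 0) :* φ :* t) refl (ι (φ 0)) y (term n 0) ⟩
        (y + 0#) * ι (φ 0) * term n 0      ∎

      next : ∀ j → φ (suc j) × term (suc n) (suc j) ≈ f (suc j) + g j
      next j = begin
        φ (suc j) × term (suc n) (suc j)
          ≈⟨ ×≈ι* (φ (suc j)) _ ⟩
        ι (φ (suc j)) * term (suc n) (suc j)
          ≈⟨ *-congˡ (trans (term-suc-suc n j) (+-congˡ (×≈ι* (suc j) _))) ⟩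
        ι (φ (suc j)) * ((y + suc j × p) * term n (suc j) + ι (suc j) * term n j)
          ≈⟨ solve 5 (λ φ a t s u → φ :* (a :* t :+ s :* u) := a :* φ :* t :+ (s :* φ) :* u)
               refl (ι (φ (suc j))) (y + suc j × p) (term n (suc j)) (ι (suc j)) (term n j) ⟩
        f (suc j) + ι (suc j) * ι (φ (suc j)) * term n j
          ≈⟨ +-congˡ (*-congʳ (ι-homo-* (suc j) (φ (suc j)))) ⟨
        f (suc j) + g j ∎

      combine : ∀ j → f j + g j ≈
        α * (φ₀ j × term n j) + β * (φ₁ j × term n j) + γ * (φ₂ j × term n j)
      combine j = begin
        f j + g j
          ≈⟨ distribʳ (term n j) _ _ ⟨
        ((y + j × p) * ι (φ j) + ι (suc j ℕ.* φ (suc j))) * term n j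
          ≈⟨ *-congʳ (eq j) ⟩
        (α * ι (φ₀ j) + β * ι (φ₁ j) + γ * ι (φ₂ j)) * term n j
          ≈⟨ solve 7 (λ α a β b γ c t → (α :* a :+ β :* b :+ γ :* c) :* t :=
               α :* (a :* t) :+ β :* (b :* t) :+ γ :* (c :* t))
               refl α (ι (φ₀ j)) β (ι (φ₁ j)) γ (ι (φ₂ j)) (term n j) ⟩
        α * (ι (φ₀ j) * term n j) + β * (ι (φ₁ j) * term n j) + γ * (ι (φ₂ j) * term n j)
          ≈⟨ +-cong (+-cong (*-congˡ (×≈ι* (φ₀ j) _)) (*-congˡ (×≈ι* (φ₁ j) _))) (*-congˡ (×≈ι* (φ₂ j) _)) ⟨
        α * (φ₀ j × term n j) + β * (φ₁ j × term n j) + γ * (φ₂ j × term n j) ∎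

    -- Coefficients of F G^k, since E^k / (1 - E)^{k+1} is the sum of C(j, k) E^j.
    V : ℕ → ℕ → Carrier
    V n k = rowSum (_C k) n

    V-0-0 : V 0 0 ≈ 1#
    V-0-0 = begin
      (w 0 0 * 1# + 0#) + 0# + 0#
        ≈⟨ solve 1 (λ w → (w :* con 1 :+ con 0) :+ con 0 :+ con 0 := w) refl (w 0 0) ⟩
      w 0 0                         ≈⟨ w-0-0 ⟩
      1#                            ∎

    V-suc-0 : ∀ n → V (suc n) 0 ≈ 0# * V n 0 + b 0 * V n 0 + (p + 1#) * V n 1
    -- There is no column before 0: the first slot is a filler with coefficient `0#`.
    V-suc-0 = rowSum-suc {_C 0} {_C 0} {_C 0} {_C 1} 0# (b 0) (p + 1#) λ j → begin
      (y + j × p) * ι 1 + ι (suc j ℕ.* 1)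
        ≈⟨ +-cong (*-congʳ (+-congˡ (×≈ι* j p))) (reflexive (≡.cong ι (ℕ.*-identityʳ (suc j)))) ⟩
      (y + ι j * p) * ι 1 + ι (suc j)
        ≈⟨ solve 3 (λ y p j → (y :+ j :* p) :* (con 1 :+ con 0) :+ (con 1 :+ j) :=
               con 0 :* (con 1 :+ con 0) :+ (y :+ con 1 :+ con 0) :* (con 1 :+ con 0) :+ (p :+ con 1) :* j)
             refl y p (ι j) ⟩
      0# * ι 1 + (y + 1# + 0#) * ι 1 + (p + 1#) * ι j
        ≈⟨ +-cong (+-congˡ (*-congʳ (b≈ 0))) (*-congˡ (reflexive (≡.cong ι (nC1≡n j)))) ⟨
      0# * ι 1 + b 0 * ι 1 + (p + 1#) * ι (j C 1) ∎

    V-suc-suc : ∀ n k → V (suc n) (suc k) ≈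
      ι (suc k) * V n k + b (suc k) * V n (suc k) + (p + 1#) * ι (2 ℕ.+ k) * V n (2 ℕ.+ k)
    V-suc-suc n k = rowSum-suc {_C suc k} {_C k} {_C suc k} {_C (2 ℕ.+ k)}
      (ι (suc k)) (b (suc k)) ((p + 1#) * ι (2 ℕ.+ k)) coefficients n
      where
      coefficients : ∀ j → (y + j × p) * ι (j C suc k) + ι (suc j ℕ.* (suc j C suc k)) ≈
        ι (suc k) * ι (j C k) + b (suc k) * ι (j C suc k) + (p + 1#) * ι (2 ℕ.+ k) * ι (j C (2 ℕ.+ k))
      coefficients j = begin
        (y + j × p) * c₁ + ι (suc j ℕ.* (suc j C suc k))
          ≈⟨ +-cong (*-congʳ (+-congˡ (×≈ι* j p))) ι-C-absorb-suc ⟩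
        (y + ι j * p) * c₁ + (s * c₀ + (1# + 2 × 1# * s) * c₁ + t * c₂)
          -- Isolates j C(j, k + 1), from which absorption removes the factor j.
          ≈⟨ solve 8 (λ y j p s t c₀ c₁ c₂ → let two = con 1 :+ (con 1 :+ con 0) in
                 (y :+ j :* p) :* c₁ :+ (s :* c₀ :+ (con 1 :+ two :* s) :* c₁ :+ t :* c₂) :=
                 y :* c₁ :+ p :* (j :* c₁) :+ (s :* c₀ :+ (con 1 :+ two :* s) :* c₁ :+ t :* c₂))
               refl y (ι j) p s t c₀ c₁ c₂ ⟩
        y * c₁ + p * (ι j * c₁) + (s * c₀ + (1# + 2 × 1# * s) * c₁ + t * c₂)
          ≈⟨ +-congʳ (+-congˡ (*-congˡ ι-C-absorb)) ⟩
        y * c₁ + p * (t * c₂ + s * c₁) + (s * c₀ + (1# + 2 × 1# * s) * c₁ + t * c₂)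
          ≈⟨ solve 7 (λ y p s t c₀ c₁ c₂ → let two = con 1 :+ (con 1 :+ con 0) in
                 y :* c₁ :+ p :* (t :* c₂ :+ s :* c₁) :+ (s :* c₀ :+ (con 1 :+ two :* s) :* c₁ :+ t :* c₂) :=
                 s :* c₀ :+ (y :+ con 1 :+ s :* (p :+ two)) :* c₁ :+ (p :+ con 1) :* t :* c₂)
               refl y p s t c₀ c₁ c₂ ⟩
        s * c₀ + (y + 1# + s * (p + 2 × 1#)) * c₁ + (p + 1#) * t * c₂
          ≈⟨ +-congʳ (+-congˡ (*-congʳ (trans (b≈ (suc k)) (+-congˡ (×≈ι* (suc k) _))))) ⟨
        s * c₀ + b (suc k) * c₁ + (p + 1#) * t * c₂ ∎
        where
        s = ι (suc k)
        t = ι (2 ℕ.+ k)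
        c₀ = ι (j C k)
        c₁ = ι (j C suc k)
        c₂ = ι (j C (2 ℕ.+ k))
        ι-C-absorb : ι j * c₁ ≈ t * c₂ + s * c₁
        ι-C-absorb = begin
          ι j * c₁                          ≈⟨ ι-homo-* j _ ⟨
          ι (j ℕ.* (j C suc k))             ≡⟨ ≡.cong ι (C-absorb j (suc k)) ⟨
          ι ((2 ℕ.+ k) ℕ.* (j C (2 ℕ.+ k)) ℕ.+ suc k ℕ.* (j C suc k))
            ≈⟨ ι-homo-+ ((2 ℕ.+ k) ℕ.* (j C (2 ℕ.+ k))) _ ⟩
          ι ((2 ℕ.+ k) ℕ.* (j C (2 ℕ.+ k))) + ι (suc k ℕ.* (j C suc k))
            ≈⟨ +-cong (ι-homo-* (2 ℕ.+ k) (j C (2 ℕ.+ k))) (ι-homo-* (suc k) (j C suc k)) ⟩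
          t * c₂ + s * c₁                   ∎
        ι-C-absorb-suc : ι (suc j ℕ.* (suc j C suc k)) ≈ s * c₀ + (1# + 2 × 1# * s) * c₁ + t * c₂
        ι-C-absorb-suc = begin
          ι (suc j ℕ.* (suc j C suc k))
            ≡⟨ ≡.cong ι (C-absorb-suc j k) ⟩
          ι (n₀ ℕ.+ n₁ ℕ.+ n₂)
            ≈⟨ trans (ι-homo-+ (n₀ ℕ.+ n₁) n₂) (+-congʳ (ι-homo-+ n₀ n₁)) ⟩
          ι n₀ + ι n₁ + ι n₂
            ≈⟨ +-cong (+-cong (ι-homo-* (suc k) (j C k))
                 (trans (ι-homo-* (1 ℕ.+ 2 ℕ.* suc k) (j C suc k)) (*-congʳ (+-congˡ (ι-homo-* 2 (suc k))))))
                 (ι-homo-* (2 ℕ.+ k) (j C (2 ℕ.+ k))) ⟩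
          s * c₀ + (1# + 2 × 1# * s) * c₁ + t * c₂ ∎
          where
          n₀ = suc k ℕ.* (j C k)
          n₁ = (1 ℕ.+ 2 ℕ.* suc k) ℕ.* (j C suc k)
          n₂ = (2 ℕ.+ k) ℕ.* (j C (2 ℕ.+ k))

    lam-suc≈ : ∀ k → lam (suc k) ≈ ι (suc k) * ι (suc k) * (p + 1#)
    lam-suc≈ k = begin
      lam (suc k)                           ≈⟨ lam≈ (suc k) ⟩
      (suc k ℕ.^ 2) × (p + 1#)              ≈⟨ ×≈ι* (suc k ℕ.^ 2) _ ⟩
      ι (suc k ℕ.* (suc k ℕ.* 1)) * (p + 1#)
        ≡⟨ ≡.cong (λ x → ι (suc k ℕ.* x) * (p + 1#)) (ℕ.*-identityʳ (suc k)) ⟩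
      ι (suc k ℕ.* suc k) * (p + 1#)        ≈⟨ *-congʳ (ι-homo-* (suc k) (suc k)) ⟩
      ι (suc k) * ι (suc k) * (p + 1#)      ∎

    -- `V` has up weight k + 1 out of column k and down weight (p + 1)(k + 1) out of column k + 1.
    -- Scaling column k by k! turns these into 1 and (k + 1)² (p + 1), the weights of `T`.
    V≈T : ∀ n k → V n k ≈ ι (k !) * T n k
    V≈T zero    zero    = begin
      V 0 0        ≈⟨ V-0-0 ⟩
      1#           ≈⟨ +-identityʳ 1# ⟨
      ι 1          ≈⟨ *-identityʳ _ ⟨
      ι 1 * 1#     ∎
    V≈T zero    (suc k) = trans (+-identityʳ 0#) (sym (zeroʳ _))
    V≈T (suc n) zero    = begin
      V (suc n) 0
        ≈⟨ V-suc-0 n ⟩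
      0# * V n 0 + b 0 * V n 0 + (p + 1#) * V n 1
        ≈⟨ +-cong (+-congˡ (*-congˡ (V≈T n 0))) (*-congˡ (V≈T n 1)) ⟩
      0# * V n 0 + b 0 * (ι 1 * T n 0) + (p + 1#) * (ι 1 * T n 1)
        ≈⟨ solve 5 (λ v b x c z → let one = con 1 :+ con 0 in
               con 0 :* v :+ b :* (one :* x) :+ c :* (one :* z) :=
               one :* (b :* x :+ one :* one :* c :* z))
             refl (V n 0) (b 0) (T n 0) (p + 1#) (T n 1) ⟩
      ι 1 * (b 0 * T n 0 + ι 1 * ι 1 * (p + 1#) * T n 1)
        ≈⟨ *-congˡ (+-congˡ (*-congʳ (lam-suc≈ 0))) ⟨
      ι 1 * (b 0 * T n 0 + lam 1 * T n 1) ∎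
    V≈T (suc n) (suc k) = begin
      V (suc n) (suc k)
        ≈⟨ V-suc-suc n k ⟩
      s * V n k + b (suc k) * V n (suc k) + (p + 1#) * t * V n (2 ℕ.+ k)
        ≈⟨ +-cong (+-cong (*-congˡ (V≈T n k)) (*-congˡ (trans (V≈T n (suc k)) (*-congʳ ι-suc!))))
                  (*-congˡ (trans (V≈T n (2 ℕ.+ k)) (*-congʳ (trans (ι-homo-* (2 ℕ.+ k) (suc k !)) (*-congˡ ι-suc!))))) ⟩
      s * (f * T n k) + b (suc k) * (s * f * T n (suc k)) + (p + 1#) * t * (t * (s * f) * T n (2 ℕ.+ k))
        ≈⟨ solve 8 (λ s t f b c x₀ x₁ x₂ →
               s :* (f :* x₀) :+ b :* (s :* f :* x₁) :+ c :* t :* (t :* (s :* f) :* x₂) :=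
               s :* f :* (x₀ :+ b :* x₁ :+ t :* t :* c :* x₂))
             refl s t f (b (suc k)) (p + 1#) (T n k) (T n (suc k)) (T n (2 ℕ.+ k)) ⟩
      s * f * (T n k + b (suc k) * T n (suc k) + t * t * (p + 1#) * T n (2 ℕ.+ k))
        ≈⟨ *-cong ι-suc! (+-congˡ (*-congʳ (lam-suc≈ (suc k)))) ⟨
      ι (suc k !) * T (suc n) (suc k) ∎
      where
      s = ι (suc k)
      t = ι (2 ℕ.+ k)
      f = ι (k !)
      ι-suc! : ι (suc k !) ≈ s * f
      ι-suc! = ι-homo-* (suc k) (k !)

    eulerian≈moment : ∀ n → ∑[ j < suc n ] term n (toℕ j) ≈ moment n
    eulerian≈moment n = begin
      ∑[ j < suc n ] term n (toℕ j)   ≈⟨ sum-cong-≋ {suc n} (λ j → ×-homo-1 (term n (toℕ j))) ⟨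
      V n 0                           ≈⟨ V≈T n 0 ⟩
      ι 1 * T n 0                     ≈⟨ trans (*-congʳ (×-homo-1 1#)) (*-identityˡ _) ⟩
      T n 0                           ∎

    Λ≈ : ∀ k → Λ k ≈ (p + 1#) ^ k * ι ((k !) ℕ.^ 2)
    Λ≈ zero    = sym (trans (*-identityˡ _) (+-identityʳ 1#))
    Λ≈ (suc k) = begin
      Λ k * lam (suc k)
        ≈⟨ *-cong (Λ≈ k) (trans (lam≈ (suc k)) (×≈ι* (suc k ℕ.^ 2) _)) ⟩
      (p + 1#) ^ k * ι ((k !) ℕ.^ 2) * (ι (suc k ℕ.^ 2) * (p + 1#))
        ≈⟨ solve 4 (λ c e f s → e :* f :* (s :* c) := c :* e :* (s :* f))
             refl (p + 1#) ((p + 1#) ^ k) (ι ((k !) ℕ.^ 2)) (ι (suc k ℕ.^ 2)) ⟩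
      (p + 1#) ^ suc k * (ι (suc k ℕ.^ 2) * ι ((k !) ℕ.^ 2))
        ≈⟨ *-congˡ (ι-homo-* (suc k ℕ.^ 2) ((k !) ℕ.^ 2)) ⟨
      (p + 1#) ^ suc k * ι (suc k ℕ.^ 2 ℕ.* (k !) ℕ.^ 2)
        ≡⟨ ≡.cong (λ x → (p + 1#) ^ suc k * ι x) (ℕExp.^-distrib-* (suc k) (k !) 2) ⟨
      (p + 1#) ^ suc k * ι ((suc k !) ℕ.^ 2) ∎

    -- Arbitrary exponents and factors are allowed because the induction shifts both sequences.
    ∏-^-ι : ∀ x n (d f : ℕ → ℕ) →
      ∏ n (λ k → x ^ d k * ι (f k)) ≈ x ^ ListAction.sum (applyUpTo d n) * ι (product (applyUpTo f n))
    ∏-^-ι x zero    d f = sym (trans (*-identityˡ _) (+-identityʳ 1#))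
    ∏-^-ι x (suc n) d f = begin
      x ^ d 0 * ι (f 0) * ∏ n (λ k → x ^ d (suc k) * ι (f (suc k)))
        ≈⟨ *-congˡ (∏-^-ι x n (d ∘ suc) (f ∘ suc)) ⟩
      x ^ d 0 * ι (f 0) * (x ^ ds * ι fs)
        ≈⟨ solve 4 (λ a b c d → a :* b :* (c :* d) := (a :* c) :* (b :* d))
             refl (x ^ d 0) (ι (f 0)) (x ^ ds) (ι fs) ⟩
      x ^ d 0 * x ^ ds * (ι (f 0) * ι fs)
        ≈⟨ *-cong (^-homo-* x (d 0) ds) (ι-homo-* (f 0) fs) ⟨
      x ^ (d 0 ℕ.+ ds) * ι (f 0 ℕ.* fs) ∎
      where
      ds = ListAction.sum (applyUpTo (d ∘ suc) n)
      fs = product (applyUpTo (f ∘ suc) n)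

    ∏Λ≈ : ∀ n → ∏ n Λ ≈ (p + 1#) ^ (n C 2) * ι (product (map (λ k → (k !) ℕ.^ 2) (upTo n)))
    ∏Λ≈ n = begin
      ∏ n Λ
        ≈⟨ ∏-cong n Λ≈ ⟩
      ∏ n (λ k → (p + 1#) ^ k * ι ((k !) ℕ.^ 2))
        ≈⟨ ∏-^-ι (p + 1#) n id (λ k → (k !) ℕ.^ 2) ⟩
      (p + 1#) ^ ListAction.sum (upTo n) * ι (product (applyUpTo (λ k → (k !) ℕ.^ 2) n))
        ≡⟨ ≡.cong₂ (λ e l → (p + 1#) ^ e * ι (product l)) (sum-upTo n)
                   (≡.sym (map-upTo (λ k → (k !) ℕ.^ 2) n)) ⟩
      (p + 1#) ^ (n C 2) * ι (product (map (λ k → (k !) ℕ.^ 2) (upTo n))) ∎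

-- Passage to polynomials in x and conclusion.

module ConstProperties {c ℓ} (R : CommutativeRing c ℓ) where

  private module R = CommutativeRing R
  open Polynomial R
  open Mult R.semiring using () renaming (_×_ to _×ᴿ_)
  open CommutativeRing commutativeRing using (0#; +-congˡ; sym; trans)
  open Mult (CommutativeRing.semiring commutativeRing) using (_×_)

  const-cong : ∀ {x y} → x R.≈ y → const x ≋ const y
  const-cong e = mk≋ λ { zero → e ; (suc n) → R.refl }

  const-0 : const R.0# ≋ 0#
  const-0 = mk≋ λ { zero → R.refl ; (suc n) → R.refl }

  const-* : ∀ x y → const (x R.* y) ≋ const x * const y
  const-* x y = mk≋ λ { zero → R.sym (R.+-identityʳ _) ; (suc n) → R.refl }

  const-× : ∀ n x → const (n ×ᴿ x) ≋ n × const x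
  const-× zero    x = const-0
  const-× (suc n) x = +-congˡ {const x} (const-× n x)

module _ {c ℓ} (A : CommutativeRing c ℓ) where

  open CommutativeRing A hiding (zero)
  open Mult semiring
  open RingProperties ring using (//-rightDividesˡ; +-cancelʳ)
  open MultipleProperties A
  open SetoidReasoning setoid
  open Solver commutativeSemiring

  -- Rewrites b_n in terms of y = x - 1. Adding n (m - 2) to both sides leaves an identity without
  -- subtraction, which the semiring solver can treat.
  b-shift : ∀ n X M →
    X * (n × M + 1#) - n × (M - 2 × 1#) ≈
    (X - 1#) + 1# + n × (M * (X - 1#) + 2 × 1#)
  b-shift n X M = +-cancelʳ (n × u) _ _ (begin
    X * (n × M + 1#) - n × u + n × u
      ≈⟨ //-rightDividesˡ _ _ ⟩
    X * (n × M + 1#)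
      ≈⟨ *-cong (sym (//-rightDividesˡ 1# X)) (+-congʳ (×≈ι* n M)) ⟩
    (y + 1#) * (ι n * M + 1#)
      ≈⟨ solve 3 (λ y n M → (y :+ con 1) :* (n :* M :+ con 1) :=
           y :+ con 1 :+ n :* (M :* y) :+ n :* M) refl y (ι n) M ⟩
    y + 1# + ι n * (M * y) + ι n * M
      ≈⟨ +-congˡ (*-congˡ (//-rightDividesˡ (2 × 1#) M)) ⟨
    y + 1# + ι n * (M * y) + ι n * (u + 2 × 1#)
      ≈⟨ solve 5 (λ y n q u two → y :+ con 1 :+ n :* q :+ n :* (u :+ two) :=
           y :+ con 1 :+ n :* (q :+ two) :+ n :* u) refl y (ι n) (M * y) u (2 × 1#) ⟩
    y + 1# + ι n * (M * y + 2 × 1#) + ι n * u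
      ≈⟨ +-cong (+-congˡ (×≈ι* n _)) (×≈ι* n u) ⟨
    y + 1# + n × (M * y + 2 × 1#) + n × u ∎)
    where
    y u : Carrier
    y = X - 1#
    u = M - 2 × 1#

mainTheorem4 :
    ∀ {c ℓ} (R : CommutativeRing c ℓ) (m : CommutativeRing.Carrier R) →
    let open EulerianDowling R m in
    (convergent b lam ⟶ 𝒜)
    Product.×
    (∀ (n : ℕ) →
      hankelTransform 𝒜 n
        ≈ (const m * (X - 1#) + 1#) ^ (suc n C 2)
            * (product (map (λ k → (k !) ℕ.^ 2) (upTo (suc n))) × 1#))
mainTheorem4 R m = convergence , hankel
  where
  open EulerianDowling R m
  open CommutativeRing R[X] using (trans; sym; refl; +-congˡ; +-congʳ; *-congʳ)
  open WhitneyProperties R m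
  open ConstProperties R
  open Tableau R[X] b lam
  open DeterminantProperties R[X] using (det-cong)
  open EulerianTableau.Rows R[X] (const m) (X - 1#) (λ n k → const (W n k))
    (const-cong W-0-0)
    (λ n k n<k → trans (const-cong (W-upper n k n<k)) const-0)
    (λ n → const-cong (W-suc-0 n))
    (λ n k → trans (const-cong (W-suc-suc n k))
      (+-congˡ {const (W n (suc k))} (+-congʳ {const (W n k)} (trans (const-* _ (W n (suc k)))
        (*-congʳ {const (W n (suc k))} (const-× (suc k) m))))))
    b lam (λ n → b-shift R[X] n X (const m)) (λ n → refl)

  convergence : convergent b lam ⟶ 𝒜
  convergence d with N₀ , agree ← convergent-⟶-moment d =
    N₀ , λ N N₀≤N i i<d → trans (agree N N₀≤N i i<d) (sym (eulerian≈moment i))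

  hankel : ∀ n → _
  hankel n = trans
    (det-cong {suc n} (λ i j → eulerian≈moment (toℕ i ℕ.+ toℕ j)))
    -- The matrix has n + 1 rows, so the exponents 0, ..., n add up to C(n + 1, 2).
    (trans (hankel-moment n) (∏Λ≈ (suc n)))
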